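{- For every $\alpha\in(m,M)$, where $m=\inf_{n\ge1}b_n$ and $M=\sup_{n\ge1}b_n$, the limit $\lim_{x\to+\infty}\frac{D(x,\alpha)}{x}$ does not exist, where $D(x,\alpha)=\#\{n\in\mathbb Z:1\le n\le x,\ b_n\le\alpha\}$. That is, $(b_n)$ has no cumulative distribution function at any point of $(m,M)$.
   Context: Fix integers $p\ge 3$ and $2\le s<p$, and a set $A\subset\{0,1,\dots,p-1\}$ with $\#A=s$. Let $h:\{0,1,\dots,s-1\}\to A$ be the unique strictly increasing bijection. For a positive integer $n$ with base-$s$ expansion $n=\sum_{i=0}^k\varepsilon_i s^i$ ($\varepsilon_i\in\{0,\dots,s-1\}$, $\varepsilon_k\ne 0$), put $a_n=\sum_{i=0}^k h(\varepsilon_i)p^i$. Let $b_n=a_n/n^{\log_s p}$ for $n\ge1$. -}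

module Defs where

open import Data.Digit using (Expansion; fromDigits; toDigits)
open import Data.Fin.Base as Fin using (Fin; toℕ)
open import Data.Fin.Subset using (Subset; _∈_)
open import Data.Integer.Base as ℤ using (ℤ; +_; -[1+_])
import Data.Integer.Properties as ℤ
open import Data.List.Base using ([]; _∷_; length; map)
import Data.List.Membership.Propositional as List
open import Data.List.Relation.Unary.Unique.Propositional using (Unique)
open import Data.Nat.Base as ℕ using (ℕ; zero; suc)
import Data.Nat.Properties as ℕ
open import Data.Product.Base using (Σ; ∃; ∃-syntax; _×_; _,_; proj₁; proj₂)
open import Data.Rational.Base
  using (ℚ; 0ℚ; 1ℚ; _/_; ↥_; ↧_; ↧ₙ_; _+_; _*_; _-_; -_; 1/_; _<_; _≤_; _⊓_; _⊔_)
import Data.Rational.Base as ℚ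
import Data.Rational.Properties as ℚ
import Data.Rational.Unnormalised.Base as ℚᵘ
import Data.Rational.Unnormalised.Properties as ℚᵘ
open import Data.Sum.Base using (_⊎_; inj₁; inj₂)
open import Function.Bundles using (_⇔_)
open import Algebra.Bundles using (CommutativeRing)
open import Relation.Binary.Definitions using (tri<; tri≈; tri>)
open import Relation.Binary.PropositionalEquality
open import Relation.Nullary using (¬_; yes; no)
open import Relation.Nullary.Decidable using (fromWitness)
open import Relation.Nullary.Negation using (contradiction)

open import Algebra.Properties.CommutativeSemiring.Exp
  (CommutativeRing.commutativeSemiring ℚ.+-*-commutativeRing)
  using (_^_; ^-assocʳ; ^-distrib-*)

private
  variable
    p q r t x y z : ℚ
    i j : ℤ

0<1 : 0ℚ < 1ℚ
0<1 = ℚ.positive⁻¹ 1ℚ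

*-mono-≤ˡ : 0ℚ ≤ r → p ≤ q → r * p ≤ r * q
*-mono-≤ˡ {r} 0≤r = ℚ.*-monoˡ-≤-nonNeg r {{ℚ.nonNegative 0≤r}}

*-mono-<ˡ : 0ℚ < r → p < q → r * p < r * q
*-mono-<ˡ {r} 0<r = ℚ.*-monoʳ-<-pos r {{ℚ.positive 0<r}}

*-mono-<ʳ : 0ℚ < r → p < q → p * r < q * r
*-mono-<ʳ {r} 0<r = ℚ.*-monoˡ-<-pos r {{ℚ.positive 0<r}}

*-mono-≤ : 0ℚ ≤ p → 0ℚ ≤ y → p ≤ q → x ≤ y → p * x ≤ q * y
*-mono-≤ {p} {y} {q} {x} 0≤p 0≤y p≤q x≤y = ℚ.≤-trans (*-mono-≤ˡ 0≤p x≤y)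
  (ℚ.*-monoʳ-≤-nonNeg y {{ℚ.nonNegative 0≤y}} p≤q)

*-pos : 0ℚ < p → 0ℚ < q → 0ℚ < p * q
*-pos {p} {q} 0<p 0<q = subst (_< p * q) (ℚ.*-zeroʳ p) (*-mono-<ˡ 0<p 0<q)

inv : (p : ℚ) → 0ℚ < p → ℚ
inv p 0<p = (1/ p) {{ℚ.>-nonZero 0<p}}

inv-pos : (0<p : 0ℚ < p) → 0ℚ < inv p 0<p
inv-pos {p} 0<p = ℚ.positive⁻¹ _ {{ℚ.1/pos⇒pos p {{ℚ.positive 0<p}}}}

inv-*ˡ : (0<p : 0ℚ < p) → inv p 0<p * p ≡ 1ℚ
inv-*ˡ {p} 0<p = ℚ.*-inverseˡ p {{ℚ.>-nonZero 0<p}}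

inv-*ʳ : (0<p : 0ℚ < p) → p * inv p 0<p ≡ 1ℚ
inv-*ʳ {p} 0<p = ℚ.*-inverseʳ p {{ℚ.>-nonZero 0<p}}

*-inv-cancel : ∀ q (0<p : 0ℚ < p) → q * inv p 0<p * p ≡ q
*-inv-cancel {p} q 0<p = begin
  q * inv p 0<p * p    ≡⟨ ℚ.*-assoc q _ p ⟩
  q * (inv p 0<p * p)  ≡⟨ cong (q *_) (inv-*ˡ 0<p) ⟩
  q * 1ℚ               ≡⟨ ℚ.*-identityʳ q ⟩
  q                    ∎
  where open ≡-Reasoning

x<x+1 : ∀ x → x < x + 1ℚ
x<x+1 x = subst (_< x + 1ℚ) (ℚ.+-identityʳ x) (ℚ.+-monoʳ-< x 0<1)

*-cancel-<ʳ : 0ℚ < r → p * r < q * r → p < q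
*-cancel-<ʳ {r} 0<r = ℚ.*-cancelʳ-<-nonNeg r {{ℚ.nonNegative (ℚ.<⇒≤ 0<r)}}

fromℕ : ℕ → ℚ
fromℕ n = + n / 1

0≤fromℕ : ∀ n → 0ℚ ≤ fromℕ n
0≤fromℕ n = ℚ.nonNegative⁻¹ _ {{ℚ.normalize-nonNeg n 1}}

fromℕ-suc : ∀ n → fromℕ (suc n) ≡ 1ℚ + fromℕ n
fromℕ-suc n = ℚ.toℚᵘ-injective (begin-equality
  ℚ.toℚᵘ (fromℕ (suc n))       ≃⟨ ℚ.toℚᵘ-fromℚᵘ (ℚᵘ.mkℚᵘ (+ suc n) 0) ⟩
  ℚᵘ.mkℚᵘ (+ suc n) 0          ≃⟨ ℚᵘ.*≡* (cong (ℤ._* + 1) (sym lem)) ⟩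
  ℚᵘ.1ℚᵘ ℚᵘ.+ ℚᵘ.mkℚᵘ (+ n) 0  ≃⟨ ℚᵘ.+-congʳ ℚᵘ.1ℚᵘ (ℚ.toℚᵘ-fromℚᵘ (ℚᵘ.mkℚᵘ (+ n) 0)) ⟨
  ℚᵘ.1ℚᵘ ℚᵘ.+ ℚ.toℚᵘ (fromℕ n) ≃⟨ ℚ.toℚᵘ-homo-+ 1ℚ (fromℕ n) ⟨
  ℚ.toℚᵘ (1ℚ + fromℕ n)        ∎)
  where
  open ℚᵘ.≤-Reasoning
  lem : + 1 ℤ.* + 1 ℤ.+ + n ℤ.* + 1 ≡ + suc n
  lem = cong (λ k → + 1 ℤ.+ k) (ℤ.*-identityʳ (+ n))

1≤fromℕ : ∀ n .{{_ : ℕ.NonZero n}} → 1ℚ ≤ fromℕ n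
1≤fromℕ (suc n) = subst₂ _≤_ (ℚ.+-identityʳ 1ℚ) (sym (fromℕ-suc n))
  (ℚ.+-monoʳ-≤ 1ℚ (0≤fromℕ n))

1<fromℕ : ∀ n → 1 ℕ.< n → 1ℚ < fromℕ n
1<fromℕ (suc (suc n)) _ = subst₂ _<_ (ℚ.+-identityʳ 1ℚ) (sym (fromℕ-suc (suc n)))
  (ℚ.+-monoʳ-< 1ℚ (ℚ.<-≤-trans 0<1 (1≤fromℕ (suc n))))
1<fromℕ (suc zero) (ℕ.s≤s ())

drop-/-≤ : ∀ i m j n .{{_ : ℕ.NonZero m}} .{{_ : ℕ.NonZero n}} →
           i / m ≤ j / n → i ℤ.* + n ℤ.≤ j ℤ.* + m
drop-/-≤ i m@(suc _) j n@(suc _) i/m≤j/n = ℚᵘ.drop-*≤* (begin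
  ℚᵘ.mkℚᵘ i (ℕ.pred m)  ≃⟨ ℚ.toℚᵘ-fromℚᵘ (ℚᵘ.mkℚᵘ i (ℕ.pred m)) ⟨
  ℚ.toℚᵘ (i / m)        ≤⟨ ℚ.toℚᵘ-mono-≤ i/m≤j/n ⟩
  ℚ.toℚᵘ (j / n)        ≃⟨ ℚ.toℚᵘ-fromℚᵘ (ℚᵘ.mkℚᵘ j (ℕ.pred n)) ⟩
  ℚᵘ.mkℚᵘ j (ℕ.pred n)  ∎)
  where open ℚᵘ.≤-Reasoning

mk-/-< : ∀ i m j n .{{_ : ℕ.NonZero m}} .{{_ : ℕ.NonZero n}} →
         i ℤ.* + n ℤ.< j ℤ.* + m → i / m < j / n
mk-/-< i m@(suc _) j n@(suc _) h = ℚ.toℚᵘ-cancel-< (begin-strict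
  ℚ.toℚᵘ (i / m)        ≃⟨ ℚ.toℚᵘ-fromℚᵘ (ℚᵘ.mkℚᵘ i (ℕ.pred m)) ⟩
  ℚᵘ.mkℚᵘ i (ℕ.pred m)  <⟨ ℚᵘ.*<* h ⟩
  ℚᵘ.mkℚᵘ j (ℕ.pred n)  ≃⟨ ℚ.toℚᵘ-fromℚᵘ (ℚᵘ.mkℚᵘ j (ℕ.pred n)) ⟨
  ℚ.toℚᵘ (j / n)        ∎)
  where open ℚᵘ.≤-Reasoning

cross-/ : ∀ i n .{{_ : ℕ.NonZero n}} → ↥ (i / n) ℤ.* + n ≡ i ℤ.* ↧ (i / n)
cross-/ i n@(suc _) = ℚᵘ.drop-*≡* (ℚᵘ.≃-trans (ℚᵘ.≃-reflexive (lem (i / n)))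
    (ℚ.toℚᵘ-fromℚᵘ (ℚᵘ.mkℚᵘ i (ℕ.pred n))))
  where
  lem : ∀ q → ℚᵘ.mkℚᵘ (↥ q) (ℚ.ℚ.denominator-1 q) ≡ ℚ.toℚᵘ q
  lem record{} = refl

i≤∣i∣ : ∀ i → i ℤ.≤ + ℤ.∣ i ∣
i≤∣i∣ (+ n)    = ℤ.≤-refl
i≤∣i∣ -[1+ n ] = ℤ.-≤+

≤⇒+ : i ℤ.≤ j → j ≡ i ℤ.+ + ℤ.∣ j ℤ.- i ∣
≤⇒+ {i} {j} i≤j = begin
  j                         ≡⟨ ℤ.+-identityʳ j ⟨
  j ℤ.+ + 0                 ≡⟨ cong (ℤ._+_ j) (ℤ.+-inverseˡ i) ⟨
  j ℤ.+ (ℤ.- i ℤ.+ i)       ≡⟨ ℤ.+-assoc j (ℤ.- i) i ⟨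
  j ℤ.- i ℤ.+ i             ≡⟨ ℤ.+-comm (j ℤ.- i) i ⟩
  i ℤ.+ (j ℤ.- i)           ≡⟨ cong (ℤ._+_ i) (ℤ.0≤i⇒+∣i∣≡i (ℤ.i≤j⇒0≤j-i i≤j)) ⟨
  i ℤ.+ + ℤ.∣ j ℤ.- i ∣     ∎
  where open ≡-Reasoning

^-pos : 0ℚ < p → ∀ n → 0ℚ < p ^ n
^-pos 0<p zero    = 0<1
^-pos 0<p (suc n) = *-pos 0<p (^-pos 0<p n)

^-mono-≤ : 0ℚ < p → p ≤ q → ∀ n → p ^ n ≤ q ^ n
^-mono-≤ 0<p p≤q zero    = ℚ.≤-refl
^-mono-≤ 0<p p≤q (suc n) = *-mono-≤ (ℚ.<⇒≤ 0<p)
  (ℚ.<⇒≤ (^-pos (ℚ.<-≤-trans 0<p p≤q) n)) p≤q (^-mono-≤ 0<p p≤q n)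

^-mono-< : 0ℚ < p → p < q → ∀ n .{{_ : ℕ.NonZero n}} → p ^ n < q ^ n
^-mono-< {p} {q} 0<p p<q (suc n) = ℚ.<-≤-trans
  (*-mono-<ʳ (^-pos 0<p n) p<q)
  (*-mono-≤ˡ (ℚ.<⇒≤ (ℚ.<-trans 0<p p<q)) (^-mono-≤ 0<p (ℚ.<⇒≤ p<q) n))

^-cancel-≤ : 0ℚ < q → ∀ n .{{_ : ℕ.NonZero n}} → p ^ n ≤ q ^ n → p ≤ q
^-cancel-≤ {q} {p} 0<q n pⁿ≤qⁿ with p ℚ.≤? q
... | yes p≤q = p≤q
... | no  p≰q = contradiction
  (ℚ.<-≤-trans (^-mono-< 0<q (ℚ.≰⇒> p≰q) n) pⁿ≤qⁿ) (ℚ.<-irrefl refl)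

1≤^ : 1ℚ ≤ p → ∀ n → 1ℚ ≤ p ^ n
1≤^ 1≤p zero    = ℚ.≤-refl
1≤^ 1≤p (suc n) = *-mono-≤ (ℚ.<⇒≤ 0<1)
  (ℚ.<⇒≤ (^-pos (ℚ.<-≤-trans 0<1 1≤p) n)) 1≤p (1≤^ 1≤p n)

p≤p^n : 1ℚ ≤ p → ∀ n .{{_ : ℕ.NonZero n}} → p ≤ p ^ n
p≤p^n {p} 1≤p (suc n) = subst (_≤ p * p ^ n) (ℚ.*-identityʳ p)
  (*-mono-≤ˡ (ℚ.<⇒≤ (ℚ.<-≤-trans 0<1 1≤p)) (1≤^ 1≤p n))

^≤1 : 0ℚ < p → p ≤ 1ℚ → ∀ n → p ^ n ≤ 1ℚ
^≤1 0<p p≤1 zero    = ℚ.≤-refl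
^≤1 0<p p≤1 (suc n) = *-mono-≤ (ℚ.<⇒≤ 0<p) (ℚ.<⇒≤ 0<1) p≤1 (^≤1 0<p p≤1 n)

p^n≤p : 0ℚ < p → p ≤ 1ℚ → ∀ n .{{_ : ℕ.NonZero n}} → p ^ n ≤ p
p^n≤p {p} 0<p p≤1 (suc n) = subst (p * p ^ n ≤_) (ℚ.*-identityʳ p)
  (*-mono-≤ˡ (ℚ.<⇒≤ 0<p) (^≤1 0<p p≤1 n))

^-comm : ∀ p m n → (p ^ m) ^ n ≡ (p ^ n) ^ m
^-comm p m n = begin
  (p ^ m) ^ n    ≡⟨ ^-assocʳ p m n ⟩
  p ^ (m ℕ.* n)  ≡⟨ cong (p ^_) (ℕ.*-comm m n) ⟩
  p ^ (n ℕ.* m)  ≡⟨ ^-assocʳ p n m ⟨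
  (p ^ n) ^ m    ∎
  where open ≡-Reasoning

x<fromℕ : ∀ x → ∃[ n ] x < fromℕ n
x<fromℕ x = suc ℤ.∣ ↥ x ∣ , subst (_< fromℕ (suc ℤ.∣ ↥ x ∣)) (ℚ.↥p/↧p≡p x)
  (mk-/-< (↥ x) (↧ₙ x) (+ suc ℤ.∣ ↥ x ∣) 1 (lem (↥ x) (ℚ.ℚ.denominator-1 x)))
  where
  lem : ∀ i d → i ℤ.* + 1 ℤ.< + suc ℤ.∣ i ∣ ℤ.* + suc d
  lem i d = ℤ.≤-<-trans (ℤ.≤-reflexive (ℤ.*-identityʳ i))
    (ℤ.≤-<-trans (i≤∣i∣ i) (ℤ.+<+ (ℕ.m≤m*n (suc ℤ.∣ i ∣) (suc d))))

bernoulli : ∀ d → 0ℚ ≤ d → ∀ n → 1ℚ + fromℕ n * d ≤ (1ℚ + d) ^ n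
bernoulli d 0≤d zero    = ℚ.≤-reflexive (trans (cong (_+_ 1ℚ) (ℚ.*-zeroˡ d)) (ℚ.+-identityʳ 1ℚ))
bernoulli d 0≤d (suc n) = begin
  1ℚ + fromℕ (suc n) * d                ≡⟨ cong (λ k → 1ℚ + k * d) (fromℕ-suc n) ⟩
  1ℚ + (1ℚ + fromℕ n) * d               ≡⟨ cong (_+_ 1ℚ) (ℚ.*-distribʳ-+ d 1ℚ (fromℕ n)) ⟩
  1ℚ + (1ℚ * d + fromℕ n * d)           ≡⟨ cong (λ k → 1ℚ + (k + fromℕ n * d)) (ℚ.*-identityˡ d) ⟩
  1ℚ + (d + nd)                         ≡⟨ cong (_+_ 1ℚ) (ℚ.+-comm d nd) ⟩
  1ℚ + (nd + d)                         ≡⟨ ℚ.+-assoc 1ℚ nd d ⟨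
  1ℚ + nd + d                           ≤⟨ ℚ.+-monoʳ-≤ (1ℚ + nd) d≤ ⟩
  1ℚ + nd + (1ℚ + nd) * d               ≡⟨ cong (_+ (1ℚ + nd) * d) (ℚ.*-identityʳ (1ℚ + nd)) ⟨
  (1ℚ + nd) * 1ℚ + (1ℚ + nd) * d        ≡⟨ ℚ.*-distribˡ-+ (1ℚ + nd) 1ℚ d ⟨
  (1ℚ + nd) * (1ℚ + d)                  ≡⟨ ℚ.*-comm (1ℚ + nd) (1ℚ + d) ⟩
  (1ℚ + d) * (1ℚ + nd)                  ≤⟨ *-mono-≤ˡ 0≤1+d (bernoulli d 0≤d n) ⟩
  (1ℚ + d) * (1ℚ + d) ^ n               ∎
  where
  open ℚ.≤-Reasoning
  nd = fromℕ n * d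
  0≤nd : 0ℚ ≤ nd
  0≤nd = subst (_≤ nd) (ℚ.*-zeroʳ (fromℕ n)) (*-mono-≤ˡ (0≤fromℕ n) 0≤d)
  0≤1+d : 0ℚ ≤ 1ℚ + d
  0≤1+d = ℚ.+-mono-≤ (ℚ.<⇒≤ 0<1) 0≤d
  d≤ : d ≤ (1ℚ + nd) * d
  d≤ = begin
    d              ≡⟨ ℚ.*-identityˡ d ⟨
    1ℚ * d         ≡⟨ cong (_* d) (ℚ.+-identityʳ 1ℚ) ⟨
    (1ℚ + 0ℚ) * d  ≤⟨ ℚ.*-monoʳ-≤-nonNeg d {{ℚ.nonNegative 0≤d}} (ℚ.+-monoʳ-≤ 1ℚ 0≤nd) ⟩
    (1ℚ + nd) * d  ∎

x-y+y : ∀ x y → x - y + y ≡ x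
x-y+y x y = begin
  x - y + y      ≡⟨ ℚ.+-assoc x (- y) y ⟩
  x + (- y + y)  ≡⟨ cong (_+_ x) (ℚ.+-inverseˡ y) ⟩
  x + 0ℚ         ≡⟨ ℚ.+-identityʳ x ⟩
  x              ∎
  where open ≡-Reasoning

x+y-y : ∀ x y → x + y - y ≡ x
x+y-y x y = begin
  x + y - y      ≡⟨ ℚ.+-assoc x y (- y) ⟩
  x + (y - y)    ≡⟨ cong (_+_ x) (ℚ.+-inverseʳ y) ⟩
  x + 0ℚ         ≡⟨ ℚ.+-identityʳ x ⟩
  x              ∎
  where open ≡-Reasoning

x<y⇒0<y-x : x < y → 0ℚ < y - x
x<y⇒0<y-x {x} {y} x<y = subst (_< y - x) (ℚ.+-inverseʳ x) (ℚ.+-monoˡ-< (- x) x<y)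

1+d-unbounded : ∀ d → 0ℚ < d → ∀ c → ∃[ n ] c ≤ (1ℚ + d) ^ n
1+d-unbounded d 0<d c = n , (begin
  c                            ≡⟨ *-inv-cancel c 0<d ⟨
  c * inv d 0<d * d            ≤⟨ ℚ.<⇒≤ (*-mono-<ʳ 0<d (proj₂ bound)) ⟩
  fromℕ n * d                  ≡⟨ ℚ.+-identityˡ _ ⟨
  0ℚ + fromℕ n * d             ≤⟨ ℚ.+-monoˡ-≤ (fromℕ n * d) (ℚ.<⇒≤ 0<1) ⟩
  1ℚ + fromℕ n * d             ≤⟨ bernoulli d (ℚ.<⇒≤ 0<d) n ⟩
  (1ℚ + d) ^ n                 ∎)
  where
  open ℚ.≤-Reasoning
  bound = x<fromℕ (c * inv d 0<d)
  n = proj₁ bound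

^-unbounded : 1ℚ < p → ∀ c → ∃[ n ] c ≤ p ^ suc n
^-unbounded {p} 1<p c = n , ℚ.≤-trans c≤ p^n≤
  where
  bound = 1+d-unbounded (p - 1ℚ) (x<y⇒0<y-x 1<p) c
  n = proj₁ bound
  c≤ : c ≤ p ^ n
  c≤ = subst (λ x → c ≤ x ^ n) (trans (ℚ.+-comm 1ℚ (p - 1ℚ)) (x-y+y p 1ℚ)) (proj₂ bound)
  p^n≤ : p ^ n ≤ p ^ suc n
  p^n≤ = subst (_≤ p ^ suc n) (ℚ.*-identityˡ (p ^ n))
    (ℚ.<⇒≤ (*-mono-<ʳ (^-pos (ℚ.<-trans 0<1 1<p) n) 1<p))

module IntegerPower (b : ℚ) (1≤b : 1ℚ ≤ b) where

  0<b : 0ℚ < b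
  0<b = ℚ.<-≤-trans 0<1 1≤b

  pow : ℤ → ℚ
  pow (+ n)    = b ^ n
  pow -[1+ n ] = inv b 0<b ^ suc n

  pow-pos : ∀ i → 0ℚ < pow i
  pow-pos (+ n)    = ^-pos 0<b n
  pow-pos -[1+ n ] = ^-pos (inv-pos 0<b) (suc n)

  pow-suc : ∀ i → pow (ℤ.suc i) ≡ b * pow i
  pow-suc (+ n)    = refl
  pow-suc -[1+ n ] = begin
    pow (ℤ.suc -[1+ n ])              ≡⟨ lem n ⟩
    inv b 0<b ^ n                     ≡⟨ ℚ.*-identityˡ _ ⟨
    1ℚ * inv b 0<b ^ n                ≡⟨ cong (_* inv b 0<b ^ n) (inv-*ʳ 0<b) ⟨
    b * inv b 0<b * inv b 0<b ^ n     ≡⟨ ℚ.*-assoc b _ _ ⟩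
    b * (inv b 0<b * inv b 0<b ^ n)   ∎
    where
    open ≡-Reasoning
    lem : ∀ n → pow (ℤ.suc -[1+ n ]) ≡ inv b 0<b ^ n
    lem zero    = refl
    lem (suc n) = refl

  pow-+ : ∀ i n → pow (i ℤ.+ + n) ≡ b ^ n * pow i
  pow-+ i zero    = trans (cong pow (ℤ.+-identityʳ i)) (sym (ℚ.*-identityˡ (pow i)))
  pow-+ i (suc n) = begin
    pow (i ℤ.+ + suc n)          ≡⟨ cong pow (lem i (+ n)) ⟩
    pow (ℤ.suc (i ℤ.+ + n))      ≡⟨ pow-suc (i ℤ.+ + n) ⟩
    b * pow (i ℤ.+ + n)          ≡⟨ cong (b *_) (pow-+ i n) ⟩
    b * (b ^ n * pow i)          ≡⟨ ℚ.*-assoc b (b ^ n) (pow i) ⟨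
    b * b ^ n * pow i            ∎
    where
    open ≡-Reasoning
    lem : ∀ i j → i ℤ.+ (+ 1 ℤ.+ j) ≡ + 1 ℤ.+ (i ℤ.+ j)
    lem i j = trans (sym (ℤ.+-assoc i (+ 1) j))
      (trans (cong (ℤ._+ j) (ℤ.+-comm i (+ 1))) (ℤ.+-assoc (+ 1) i j))

  pow-* : ∀ i n → pow (i ℤ.* + n) ≡ pow i ^ n
  pow-* (+ m) n = trans (cong pow (sym (ℤ.pos-* m n))) (sym (^-assocʳ b m n))
  pow-* -[1+ m ] zero    = cong pow (ℤ.*-zeroʳ -[1+ m ])
  pow-* -[1+ m ] (suc n) = sym (^-assocʳ (inv b 0<b) (suc m) (suc n))

  pow-mono-≤ : i ℤ.≤ j → pow i ≤ pow j
  pow-mono-≤ {i} {j} i≤j = begin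
    pow i                   ≡⟨ ℚ.*-identityˡ (pow i) ⟨
    1ℚ * pow i              ≤⟨ ℚ.*-monoʳ-≤-nonNeg (pow i)
                                 {{ℚ.nonNegative (ℚ.<⇒≤ (pow-pos i))}} (1≤^ 1≤b k) ⟩
    b ^ k * pow i           ≡⟨ pow-+ i k ⟨
    pow (i ℤ.+ + k)         ≡⟨ cong pow (≤⇒+ i≤j) ⟨
    pow j                   ∎
    where
    open ℚ.≤-Reasoning
    k = ℤ.∣ j ℤ.- i ∣

  pow-mono-< : 1ℚ < b → i ℤ.< j → pow i < pow j
  pow-mono-< {i} {j} 1<b i<j = begin-strict
    pow i              ≡⟨ ℚ.*-identityˡ (pow i) ⟨
    1ℚ * pow i         <⟨ *-mono-<ʳ (pow-pos i) 1<b ⟩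
    b * pow i          ≡⟨ pow-suc i ⟨
    pow (ℤ.suc i)      ≤⟨ pow-mono-≤ (ℤ.i<j⇒suc[i]≤j i<j) ⟩
    pow j              ∎
    where open ℚ.≤-Reasoning

  -- Rational powers of b, compared with a positive rational t by clearing
  -- the denominator of the exponent: t ≤ b^(u/v) iff t^v ≤ b^u.

  _≤b^_ : ℚ → ℚ → Set
  t ≤b^ r = t ^ ↧ₙ r ≤ pow (↥ r)

  b^_≤_ : ℚ → ℚ → Set
  b^ r ≤ t = pow (↥ r) ≤ t ^ ↧ₙ r

  pow-cross : ∀ i n .{{_ : ℕ.NonZero n}} → pow i ^ ↧ₙ (i / n) ≡ pow (↥ (i / n)) ^ n
  pow-cross i n = begin
    pow i ^ ↧ₙ (i / n)          ≡⟨ pow-* i (↧ₙ (i / n)) ⟨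
    pow (i ℤ.* ↧ (i / n))       ≡⟨ cong pow (cross-/ i n) ⟨
    pow (↥ (i / n) ℤ.* + n)     ≡⟨ pow-* (↥ (i / n)) n ⟩
    pow (↥ (i / n)) ^ n         ∎
    where open ≡-Reasoning

  ≤b^-intro : ∀ i n .{{_ : ℕ.NonZero n}} → 0ℚ < t → t ^ n ≤ pow i → t ≤b^ (i / n)
  ≤b^-intro {t} i n 0<t h = ^-cancel-≤ (pow-pos (↥ ratio)) n (begin
    (t ^ ↧ₙ ratio) ^ n      ≡⟨ ^-comm t (↧ₙ ratio) n ⟩
    (t ^ n) ^ ↧ₙ ratio      ≤⟨ ^-mono-≤ (^-pos 0<t n) h (↧ₙ ratio) ⟩
    pow i ^ ↧ₙ ratio        ≡⟨ pow-cross i n ⟩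
    pow (↥ ratio) ^ n       ∎)
    where
    open ℚ.≤-Reasoning
    ratio = i / n

  b^≤-intro : ∀ i n .{{_ : ℕ.NonZero n}} → 0ℚ < t → pow i ≤ t ^ n → b^ (i / n) ≤ t
  b^≤-intro {t} i n 0<t h = ^-cancel-≤ (^-pos 0<t (↧ₙ ratio)) n (begin
    pow (↥ ratio) ^ n       ≡⟨ pow-cross i n ⟨
    pow i ^ ↧ₙ ratio        ≤⟨ ^-mono-≤ (pow-pos i) h (↧ₙ ratio) ⟩
    (t ^ n) ^ ↧ₙ ratio      ≡⟨ ^-comm t n (↧ₙ ratio) ⟩
    (t ^ ↧ₙ ratio) ^ n      ∎)
    where
    open ℚ.≤-Reasoning
    ratio = i / n

  ≤b^-trans : 0ℚ < x → 0ℚ < y → x ≤b^ q → q ≤ r → b^ r ≤ y → x ≤ y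
  ≤b^-trans {x} {y} {q} {r} 0<x 0<y x≤b^q q≤r b^r≤y =
    ^-cancel-≤ 0<y v (^-cancel-≤ (^-pos 0<y v) w (begin
      (x ^ v) ^ w             ≤⟨ ^-mono-≤ (^-pos 0<x v) x≤b^q w ⟩
      pow (↥ q) ^ w           ≡⟨ pow-* (↥ q) w ⟨
      pow (↥ q ℤ.* + w)       ≤⟨ pow-mono-≤ (ℚ.drop-*≤* q≤r) ⟩
      pow (↥ r ℤ.* + v)       ≡⟨ pow-* (↥ r) v ⟩
      pow (↥ r) ^ v           ≤⟨ ^-mono-≤ (pow-pos (↥ r)) b^r≤y v ⟩
      (y ^ w) ^ v             ≡⟨ ^-comm y w v ⟩
      (y ^ v) ^ w             ∎))
    where
    open ℚ.≤-Reasoning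
    v = ↧ₙ q
    w = ↧ₙ r

  b^≤-mono : 1ℚ < b → 0ℚ < x → b^ q ≤ x → x ≤b^ r → q ≤ r
  b^≤-mono {x} {q} {r} 1<b 0<x b^q≤x x≤b^r = ℚ.≮⇒≥ λ r<q → ℚ.<-irrefl refl (begin-strict
      pow (↥ q ℤ.* + w)       ≡⟨ pow-* (↥ q) w ⟩
      pow (↥ q) ^ w           ≤⟨ ^-mono-≤ (pow-pos (↥ q)) b^q≤x w ⟩
      (x ^ v) ^ w             ≡⟨ ^-comm x v w ⟩
      (x ^ w) ^ v             ≤⟨ ^-mono-≤ (^-pos 0<x w) x≤b^r v ⟩
      pow (↥ r) ^ v           ≡⟨ pow-* (↥ r) v ⟨
      pow (↥ r ℤ.* + v)       <⟨ pow-mono-< 1<b (ℚ.drop-*<* r<q) ⟩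
      pow (↥ q ℤ.* + w)       ∎)
    where
    open ℚ.≤-Reasoning
    v = ↧ₙ q
    w = ↧ₙ r

-- Two-sided Dedekind cuts.
record ℝ : Set₁ where
  field
    Lower Upper     : ℚ → Set
    lower-inhabited : ∃ Lower
    upper-inhabited : ∃ Upper
    lower-closed    : q < r → Lower r → Lower q
    upper-closed    : q < r → Upper q → Upper r
    lower-open      : Lower q → ∃[ r ] q < r × Lower r
    upper-open      : Upper r → ∃[ q ] q < r × Upper q
    disjoint        : Lower q → ¬ Upper q
    located         : q < r → Lower q ⊎ Upper r

  lower<upper : Lower q → Upper r → q < r
  lower<upper {q} {r} lq ur with ℚ.<-cmp q r
  ... | tri< q<r _ _  = q<r
  ... | tri≈ _ refl _ = contradiction ur (disjoint lq)
  ... | tri> _ _ r<q  = contradiction ur (disjoint (lower-closed r<q lq))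

open ℝ

infix 4 _<ᵣ_ _≤ᵣ_ ∣_-_∣<_
infixl 6 _+ᵣ_

_<ᵣ_ : ℝ → ℝ → Set
x <ᵣ y = ∃[ q ] Upper x q × Lower y q

_≤ᵣ_ : ℝ → ℝ → Set
x ≤ᵣ y = ¬ (y <ᵣ x)

fromℚ : ℚ → ℝ
fromℚ p = record
  { Lower           = _< p
  ; Upper           = p <_
  ; lower-inhabited = p - 1ℚ , subst (p - 1ℚ <_) (x-y+y p 1ℚ) (x<x+1 (p - 1ℚ))
  ; upper-inhabited = p + 1ℚ , x<x+1 p
  ; lower-closed    = ℚ.<-trans
  ; upper-closed    = λ q<r p<q → ℚ.<-trans p<q q<r
  ; lower-open      = ℚ.<-dense
  ; upper-open      = λ p<r → let q , p<q , q<r = ℚ.<-dense p<r in q , q<r , p<q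
  ; disjoint        = ℚ.<-asym
  ; located         = loc
  }
  where
  loc : q < r → q < p ⊎ p < r
  loc {q} q<r with q ℚ.<? p
  ... | yes q<p = inj₁ q<p
  ... | no  q≮p = inj₂ (ℚ.≤-<-trans (ℚ.≮⇒≥ q≮p) q<r)

0ᵣ : ℝ
0ᵣ = fromℚ 0ℚ

lower-0 : ∀ x → 0ᵣ <ᵣ x → Lower x 0ℚ
lower-0 x (q , 0<q , lq) = lower-closed x 0<q lq

_+ᵣ_ : ℝ → ℚ → ℝ
x +ᵣ e = record
  { Lower           = λ q → Lower x (q - e)
  ; Upper           = λ q → Upper x (q - e)
  ; lower-inhabited = let q , lq = lower-inhabited x in
                      q + e , subst (Lower x) (sym (x+y-y q e)) lq
  ; upper-inhabited = let q , uq = upper-inhabited x in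
                      q + e , subst (Upper x) (sym (x+y-y q e)) uq
  ; lower-closed    = λ q<r → lower-closed x (ℚ.+-monoˡ-< (- e) q<r)
  ; upper-closed    = λ q<r → upper-closed x (ℚ.+-monoˡ-< (- e) q<r)
  ; lower-open      = λ {q} lq → let r , q-e<r , lr = lower-open x lq in
                      r + e , subst (_< r + e) (x-y+y q e) (ℚ.+-monoˡ-< e q-e<r)
                            , subst (Lower x) (sym (x+y-y r e)) lr
  ; upper-open      = λ {q} uq → let r , r<q-e , ur = upper-open x uq in
                      r + e , subst (r + e <_) (x-y+y q e) (ℚ.+-monoˡ-< e r<q-e)
                            , subst (Upper x) (sym (x+y-y r e)) ur
  ; disjoint        = disjoint x
  ; located         = λ q<r → located x (ℚ.+-monoˡ-< (- e) q<r)
  }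

∣_-_∣<_ : ℝ → ℝ → ℚ → Set
∣ x - y ∣< e = x <ᵣ y +ᵣ e × y <ᵣ x +ᵣ e

quotient : ℕ → (x : ℝ) → 0ᵣ <ᵣ x → ℝ
quotient n x 0<x = record
  { Lower           = λ q → ∃[ r ] Upper x r × q * r < k
  ; Upper           = λ q → ∃[ r ] 0ℚ < r × Lower x r × k < q * r
  ; lower-inhabited = - 1ℚ , negative (ℚ.negative⁻¹ (- 1ℚ))
  ; upper-inhabited = let r , 0<r , lr = lower-open x l0 in
                      (k + 1ℚ) * inv r 0<r , r , 0<r , lr ,
                      subst (k <_) (sym (*-inv-cancel (k + 1ℚ) 0<r)) (x<x+1 k)
  ; lower-closed    = λ { q<q′ (r , ur , q′r<k) →
                      r , ur , ℚ.<-trans (*-mono-<ʳ (lower<upper x l0 ur) q<q′) q′r<k }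
  ; upper-closed    = λ { q<q′ (r , 0<r , lr , k<qr) →
                      r , 0<r , lr , ℚ.<-trans k<qr (*-mono-<ʳ 0<r q<q′) }
  ; lower-open      = λ { (r , ur , qr<k) →
                      let 0<r = lower<upper x l0 ur
                          t , qr<t , t<k = ℚ.<-dense qr<k
                          eq = *-inv-cancel t 0<r
                      in t * inv r 0<r
                       , *-cancel-<ʳ 0<r (subst (_ <_) (sym eq) qr<t)
                       , r , ur , subst (_< k) (sym eq) t<k }
  ; upper-open      = λ { (r , 0<r , lr , k<qr) →
                      let t , k<t , t<qr = ℚ.<-dense k<qr
                          eq = *-inv-cancel t 0<r
                      in t * inv r 0<r
                       , *-cancel-<ʳ 0<r (subst (_< _) (sym eq) t<qr)
                       , r , 0<r , lr , subst (k <_) (sym eq) k<t }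
  ; disjoint        = λ { {q} (r , ur , qr<k) (r′ , 0<r′ , lr′ , k<qr′) →
                      let 0<q = *-cancel-<ʳ {r′} {0ℚ} {q} 0<r′
                                  (subst (_< q * r′) (sym (ℚ.*-zeroˡ r′)) (ℚ.≤-<-trans 0≤k k<qr′))
                      in ℚ.<-asym (ℚ.<-trans qr<k k<qr′) (*-mono-<ˡ {q} 0<q (lower<upper x lr′ ur)) }
  ; located         = loc
  }
  where
  k = fromℕ n
  0≤k = 0≤fromℕ n
  l0 = lower-0 x 0<x
  L U : ℚ → Set
  L q = ∃[ r ] Upper x r × q * r < k
  U q = ∃[ r ] 0ℚ < r × Lower x r × k < q * r

  negative : q < 0ℚ → L q
  negative {q} q<0 = let r , ur = upper-inhabited x in
    r , ur , ℚ.<-≤-trans (subst (q * r <_) (ℚ.*-zeroˡ r) (*-mono-<ʳ (lower<upper x l0 ur) q<0)) 0≤k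

  loc⁺ : 0ℚ < k → 0ℚ ≤ q → q < r → L q ⊎ U r
  loc⁺ {q} {r} 0<k 0≤q q<r = branch (located x c<d)
    where
    mid = ℚ.<-dense q<r
    m   = proj₁ mid
    q<m = proj₁ (proj₂ mid)
    m<r = proj₂ (proj₂ mid)
    0<m = ℚ.≤-<-trans 0≤q q<m
    0<r = ℚ.<-trans 0<m m<r
    c = k * inv r 0<r
    d = k * inv m 0<m
    0<c = *-pos 0<k (inv-pos 0<r)
    0<d = *-pos 0<k (inv-pos 0<m)
    c<d : c < d
    c<d = *-cancel-<ʳ 0<m (subst (c * m <_)
      (trans (*-inv-cancel k 0<r) (sym (*-inv-cancel k 0<m))) (*-mono-<ˡ 0<c m<r))
    branch : Lower x c ⊎ Upper x d → L q ⊎ U r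
    branch (inj₁ lc) = let e , c<e , le = lower-open x lc in
      inj₂ (e , ℚ.<-trans 0<c c<e , le ,
            subst₂ _<_ (*-inv-cancel k 0<r) (ℚ.*-comm e r) (*-mono-<ʳ 0<r c<e))
    branch (inj₂ ud) = inj₁ (d , ud ,
      subst (q * d <_) (trans (ℚ.*-comm m d) (*-inv-cancel k 0<m)) (*-mono-<ʳ 0<d q<m))

  loc : q < r → L q ⊎ U r
  loc {q} {r} q<r with q ℚ.<? 0ℚ | 0ℚ ℚ.<? k
  ... | yes q<0 | _       = inj₁ (negative q<0)
  ... | no  q≮0 | yes 0<k = loc⁺ 0<k (ℚ.≮⇒≥ q≮0) q<r
  ... | no  q≮0 | no  0≮k = let e , 0<e , le = lower-open x l0 in
    inj₂ (e , 0<e , le , ℚ.≤-<-trans (ℚ.≮⇒≥ 0≮k) (*-pos (ℚ.≤-<-trans (ℚ.≮⇒≥ q≮0) q<r) 0<e))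

module _ (b a : ℚ) (1<b : 1ℚ < b) (1≤a : 1ℚ ≤ a) where

  open IntegerPower b (ℚ.<⇒≤ 1<b)

  -- log b a is the supremum of the rationals r with b^r ≤ a and the infimum
  -- of those with a ≤ b^r; asking for a strictly larger (smaller) r keeps the
  -- cut open when log b a is itself rational.
  log : ℝ
  log = record
    { Lower           = λ q → ∃[ r ] q < r × b^ r ≤ a
    ; Upper           = λ q → ∃[ r ] r < q × a ≤b^ r
    ; lower-inhabited = - 1ℚ , 0ℚ , ℚ.negative⁻¹ (- 1ℚ) ,
                        b^≤-intro (+ 0) 1 0<a (1≤^ 1≤a 1)
    ; upper-inhabited = let n , a≤ = ^-unbounded 1<b a ; r = + suc n / 1 in
                        r + 1ℚ , r , x<x+1 r ,
                        ≤b^-intro (+ suc n) 1 0<a (subst (_≤ b ^ suc n) (sym (ℚ.*-identityʳ a)) a≤)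
    ; lower-closed    = λ { q<q′ (r , q′<r , h) → r , ℚ.<-trans q<q′ q′<r , h }
    ; upper-closed    = λ { q<q′ (r , r<q , h) → r , ℚ.<-trans r<q q<q′ , h }
    ; lower-open      = λ { (r , q<r , h) → let t , q<t , t<r = ℚ.<-dense q<r in t , q<t , r , t<r , h }
    ; upper-open      = λ { (r , r<q , h) → let t , r<t , t<q = ℚ.<-dense r<q in t , t<q , r , r<t , h }
    ; disjoint        = λ { (r , q<r , h) (r′ , r′<q , h′) →
                        ℚ.<-irrefl refl (ℚ.<-≤-trans (ℚ.<-trans r′<q q<r) (b^≤-mono 1<b 0<a h h′)) }
    ; located         = λ q<r → let m , q<m , m<r = ℚ.<-dense q<r in
                        loc m q<m m<r
    }
    where
    0<a = ℚ.<-≤-trans 0<1 1≤a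
    loc : ∀ m → q < m → m < r → (∃[ t ] q < t × b^ t ≤ a) ⊎ (∃[ t ] t < r × a ≤b^ t)
    loc m q<m m<r with ℚ.≤-total (pow (↥ m)) (a ^ ↧ₙ m)
    ... | inj₁ h = inj₁ (m , q<m , h)
    ... | inj₂ h = inj₂ (m , m<r , h)

grid : ∀ x d .{{_ : ℕ.NonZero d}} → ∃[ i ] Lower x (i / d) × Upper x ((i ℤ.+ + 2) / d)
grid x d = search start ℤ.∣ stop ℤ.- start ∣ lower-start
    (subst (λ i → Upper x (i / d)) (≤⇒+ start≤stop) upper-stop)
  where
  step : i ℤ.< j → i / d < j / d
  step {i} {j} i<j = mk-/-< i d j d (ℤ.*-monoʳ-<-pos (+ d) {{ℤ.positive (ℤ.+<+ (ℕ.>-nonZero⁻¹ d))}} i<j)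

  i<i+suc : ∀ i n → i ℤ.< i ℤ.+ + suc n
  i<i+suc i n = subst (ℤ._< i ℤ.+ + suc n) (ℤ.+-identityʳ i) (ℤ.+-monoʳ-< i (ℤ.+<+ ℕ.z<s))

  search : ∀ i n → Lower x (i / d) → Upper x ((i ℤ.+ + n) / d) →
           ∃[ i ] Lower x (i / d) × Upper x ((i ℤ.+ + 2) / d)
  search i zero    li uj = contradiction
    (subst (λ j → Upper x (j / d)) (ℤ.+-identityʳ i) uj) (disjoint x li)
  search i (suc n) li uj with located x (step (ℤ.+-monoʳ-< i (ℤ.+<+ (ℕ.n<1+n 1))))
  ... | inj₂ u = i , li , u
  ... | inj₁ l = search (i ℤ.+ + 1) n l
    (subst (λ j → Upper x (j / d)) (sym (ℤ.+-assoc i (+ 1) (+ n))) uj)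

  q₀ = proj₁ (lower-inhabited x)
  q₁ = proj₁ (upper-inhabited x)
  start stop : ℤ
  start = -[1+ ℤ.∣ ↥ q₀ ∣ ℕ.* d ]
  stop  = + suc (ℤ.∣ ↥ q₁ ∣ ℕ.* d)
  start≤stop : start ℤ.≤ stop
  start≤stop = ℤ.-≤+

  ≤stop : ∀ i e .{{_ : ℕ.NonZero e}} → i ℤ.* + d ℤ.< + suc (ℤ.∣ i ∣ ℕ.* d) ℤ.* + e
  ≤stop i e = ℤ.≤-<-trans (i≤∣i∣ (i ℤ.* + d))
    (subst₂ ℤ._<_ (cong +_ (sym (ℤ.abs-* i (+ d)))) (ℤ.pos-* (suc (ℤ.∣ i ∣ ℕ.* d)) e)
      (ℤ.+<+ (ℕ.m≤m*n (suc (ℤ.∣ i ∣ ℕ.* d)) e)))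

  upper-stop : Upper x (stop / d)
  upper-stop = upper-closed x
    (subst (_< stop / d) (ℚ.↥p/↧p≡p q₁) (mk-/-< (↥ q₁) (↧ₙ q₁) stop d (≤stop (↥ q₁) (↧ₙ q₁))))
    (proj₂ (upper-inhabited x))

  lower-start : Lower x (start / d)
  lower-start = lower-closed x
    (subst (start / d <_) (ℚ.↥p/↧p≡p q₀) (mk-/-< start d (↥ q₀) (↧ₙ q₀) lem))
    (proj₂ (lower-inhabited x))
    where
    u = ↥ q₀
    lem : start ℤ.* ↧ q₀ ℤ.< u ℤ.* + d
    lem = subst₂ ℤ._<_
      (trans (cong ℤ.-_ (cong (λ k → + suc (k ℕ.* d) ℤ.* ↧ q₀) (ℤ.∣-i∣≡∣i∣ u)))
             (ℤ.neg-distribˡ-* (+ suc (ℤ.∣ u ∣ ℕ.* d)) (↧ q₀)))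
      (trans (cong ℤ.-_ (sym (ℤ.neg-distribˡ-* u (+ d)))) (ℤ.neg-involutive (u ℤ.* + d)))
      (ℤ.neg-mono-< (≤stop (ℤ.- u) (↧ₙ q₀)))

module _ (b : ℚ) (1≤b : 1ℚ ≤ b) (y : ℝ) where

  open IntegerPower b 1≤b

  private
    L U : ℚ → Set
    L q = ∃[ r ] ∃[ t ] Lower y r × 0ℚ < t × q < t × t ≤b^ r
    U q = ∃[ r ] ∃[ t ] Upper y r × 0ℚ < t × t < q × b^ r ≤ t

    nonPositive : q ≤ 0ℚ → L q
    nonPositive {q} q≤0 = let r , lr = lower-inhabited y in
      r , τ r , lr , 0<τ r , ℚ.≤-<-trans q≤0 (0<τ r) ,
      ℚ.≤-trans (p^n≤p (0<τ r) (ℚ.p⊓q≤q (pow (↥ r)) 1ℚ) (↧ₙ r)) (ℚ.p⊓q≤p (pow (↥ r)) 1ℚ)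
      where
      τ : ℚ → ℚ
      τ r = pow (↥ r) ⊓ 1ℚ
      0<τ : ∀ r → 0ℚ < τ r
      0<τ r with ℚ.⊓-sel (pow (↥ r)) 1ℚ
      ... | inj₁ eq = subst (0ℚ <_) (sym eq) (pow-pos (↥ r))
      ... | inj₂ eq = subst (0ℚ <_) (sym eq) 0<1

    loc⁺ : 0ℚ < t → q < t → t < x → x < r → L q ⊎ U r
    loc⁺ {t} {q} {x} {r} 0<t q<t t<x x<r = branch (ℚ.≤-total (t ^ v) (pow k))
      where
      0<x = ℚ.<-trans 0<t t<x
      ρ = x * inv t 0<t
      1<ρ : 1ℚ < ρ
      1<ρ = subst (_< ρ) (inv-*ʳ 0<t) (*-mono-<ʳ (inv-pos 0<t) t<x)
      bound = ^-unbounded 1<ρ (b ^ 2)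
      v = suc (proj₁ bound)
      cell = grid y v
      k = proj₁ cell
      branch : t ^ v ≤ pow k ⊎ pow k ≤ t ^ v → L q ⊎ U r
      branch (inj₁ h) = inj₁ (k / v , t , proj₁ (proj₂ cell) , 0<t , q<t , ≤b^-intro k v 0<t h)
      branch (inj₂ h) = inj₂ ((k ℤ.+ + 2) / v , x , proj₂ (proj₂ cell) , 0<x , x<r ,
        b^≤-intro (k ℤ.+ + 2) v 0<x (begin
          pow (k ℤ.+ + 2)    ≡⟨ pow-+ k 2 ⟩
          b ^ 2 * pow k      ≤⟨ *-mono-≤ (ℚ.<⇒≤ (^-pos 0<b 2)) (ℚ.<⇒≤ (^-pos 0<t v)) (proj₂ bound) h ⟩
          ρ ^ v * t ^ v      ≡⟨ ^-distrib-* ρ t v ⟨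
          (ρ * t) ^ v        ≡⟨ cong (_^ v) (*-inv-cancel x 0<t) ⟩
          x ^ v              ∎))
        where open ℚ.≤-Reasoning

  -- b^y is the supremum of the positive rationals t with t ≤ b^r for some
  -- rational r < y and the infimum of those with b^r ≤ t for some r > y.
  rpow : ℝ
  rpow = record
    { Lower           = λ q → ∃[ r ] ∃[ t ] Lower y r × 0ℚ < t × q < t × t ≤b^ r
    ; Upper           = λ q → ∃[ r ] ∃[ t ] Upper y r × 0ℚ < t × t < q × b^ r ≤ t
    ; lower-inhabited = 0ℚ , nonPositive ℚ.≤-refl
    ; upper-inhabited = let r , ur = upper-inhabited y ; t = pow (↥ r) ⊔ 1ℚ in
                        t + 1ℚ , r , t , ur , ℚ.<-≤-trans 0<1 (ℚ.p≤q⊔p (pow (↥ r)) 1ℚ) , x<x+1 t ,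
                        ℚ.≤-trans (ℚ.p≤p⊔q (pow (↥ r)) 1ℚ) (p≤p^n (ℚ.p≤q⊔p (pow (↥ r)) 1ℚ) (↧ₙ r))
    ; lower-closed    = λ { q<q′ (r , t , lr , 0<t , q′<t , h) → r , t , lr , 0<t , ℚ.<-trans q<q′ q′<t , h }
    ; upper-closed    = λ { q<q′ (r , t , ur , 0<t , t<q , h) → r , t , ur , 0<t , ℚ.<-trans t<q q<q′ , h }
    ; lower-open      = λ { (r , t , lr , 0<t , q<t , h) →
                        let m , q<m , m<t = ℚ.<-dense q<t in m , q<m , r , t , lr , 0<t , m<t , h }
    ; upper-open      = λ { (r , t , ur , 0<t , t<q , h) →
                        let m , t<m , m<q = ℚ.<-dense t<q in m , m<q , r , t , ur , 0<t , t<m , h }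
    ; disjoint        = λ { (r , t , lr , 0<t , q<t , h) (r′ , t′ , ur′ , 0<t′ , t′<q , h′) →
                        ℚ.<-irrefl refl (ℚ.<-≤-trans (ℚ.<-trans t′<q q<t)
                          (≤b^-trans 0<t 0<t′ h (ℚ.<⇒≤ (lower<upper y lr ur′)) h′)) }
    ; located         = loc
    }
    where
    loc : q < r → L q ⊎ U r
    loc {q} {r} q<r with q ℚ.≤? 0ℚ
    ... | yes q≤0 = inj₁ (nonPositive q≤0)
    ... | no  q≰0 =
      let t , q<t , t<r = ℚ.<-dense q<r
          x , t<x , x<r = ℚ.<-dense t<r
      in loc⁺ (ℚ.<-trans (ℚ.≰⇒> q≰0) q<t) q<t t<x x<r

  rpow-pos : 0ᵣ <ᵣ rpow
  rpow-pos = let q , 0<q , lq = lower-open rpow (nonPositive ℚ.≤-refl) in q , 0<q , lq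

Sequence : Set₁
Sequence = (n : ℕ) .{{_ : ℕ.NonZero n}} → ℝ

IsInfimum : Sequence → ℝ → Set₁
IsInfimum b m = (∀ n .{{_ : ℕ.NonZero n}} → m ≤ᵣ b n) ×
                (∀ x → (∀ n .{{_ : ℕ.NonZero n}} → x ≤ᵣ b n) → x ≤ᵣ m)

IsSupremum : Sequence → ℝ → Set₁
IsSupremum b M = (∀ n .{{_ : ℕ.NonZero n}} → b n ≤ᵣ M) ×
                 (∀ x → (∀ n .{{_ : ℕ.NonZero n}} → b n ≤ᵣ x) → M ≤ᵣ x)

HasCardinality : (ℕ → Set) → ℕ → Set
HasCardinality P k = ∃[ ns ] Unique ns × (∀ n → n List.∈ ns ⇔ P n) × length ns ≡ k

-- D b x α k means #{ n | 1 ≤ n ≤ x, b n ≤ α } = k.  It is a relation because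
-- the order on ℝ is undecidable; k is unique whenever it exists.
D : Sequence → ℝ → ℝ → ℕ → Set
D b x α = HasCardinality λ n →
  Σ (ℕ.NonZero n) λ n≢0 → fromℚ (fromℕ n) ≤ᵣ x × b n {{n≢0}} ≤ᵣ α

-- Rational ε suffices since ℚ is dense in ℝ.
DensityTendsTo : Sequence → ℝ → ℝ → Set₁
DensityTendsTo b α l =
  ∀ ε → 0ℚ < ε → ∃[ X ] ∀ x (0<x : 0ᵣ <ᵣ x) → X <ᵣ x →
  ∀ k → D b x α k → ∣ quotient k x 0<x - l ∣< ε

record IsIncreasingBijection {s p : ℕ} (A : Subset p) (h : Fin s → Fin p) : Set where
  field
    increasing : ∀ {i j} → i Fin.< j → h i Fin.< h j
    into       : ∀ i → h i ∈ A
    onto       : ∀ {d} → d ∈ A → ∃[ i ] h i ≡ d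

-- Expansions list the least significant digit first, so the leading digit is
-- the last entry.  It has to be nonzero because h may send 0 to a nonzero digit.
data LeadingNonZero {s : ℕ} : Expansion s → Set where
  [_] : ∀ {d} → toℕ d ≢ 0 → LeadingNonZero (d ∷ [])
  _∷_ : ∀ d {ds} → LeadingNonZero ds → LeadingNonZero (d ∷ ds)

trim : ∀ {s} (ds : Expansion s) → fromDigits ds ≡ 0 ⊎
       ∃[ es ] fromDigits {s} es ≡ fromDigits ds × LeadingNonZero es
trim []           = inj₁ refl
trim {s} (d ∷ ds) with trim ds
... | inj₂ (es , eq , nz) = inj₂ (d ∷ es , cong (λ k → toℕ d ℕ.+ k ℕ.* s) eq , d ∷ nz)
... | inj₁ eq with toℕ d ℕ.≟ 0
...   | yes d≡0 = inj₁ (cong₂ (λ m k → m ℕ.+ k ℕ.* s) d≡0 eq)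
...   | no  d≢0 = inj₂ (d ∷ [] , cong (λ k → toℕ d ℕ.+ k ℕ.* s) (sym eq) , [ d≢0 ])

expansion : ∀ s → 2 ℕ.≤ s → ∀ n .{{_ : ℕ.NonZero n}} →
            ∃[ ds ] fromDigits {s} ds ≡ n × LeadingNonZero ds
expansion s 2≤s n with toDigits s {fromWitness 2≤s} n
... | ds , eq with trim ds
...   | inj₁ eq′            = contradiction (trans (sym eq) eq′) (ℕ.≢-nonZero⁻¹ n)
...   | inj₂ (es , eq′ , nz) = es , trans eq′ eq , nz

module DigitSequence (p s : ℕ) (2≤s : 2 ℕ.≤ s) (s<p : s ℕ.< p) (h : Fin s → Fin p) where

  a : (n : ℕ) .{{_ : ℕ.NonZero n}} → ℕ
  a n = fromDigits (map h (proj₁ (expansion s 2≤s n)))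

  logₛp : ℝ
  logₛp = log (fromℕ s) (fromℕ p) (1<fromℕ s 2≤s) (1≤fromℕ p {{ℕ.>-nonZero (ℕ.≤-<-trans ℕ.z≤n s<p)}})

  b : Sequence
  b n = quotient (a n) (rpow (fromℕ n) (1≤fromℕ n) logₛp) (rpow-pos (fromℕ n) (1≤fromℕ n) logₛp)

{-# OPTIONS --safe #-}
module Submission where

-- Write θ = log_s p > 1.  Appending k digits to n turns it into any N with
-- n s^k ≤ N < (n + 1) s^k, and then p^k a_n ≤ a_N < p^k (a_n + 1).  If
-- b_n > α, then b_N > α for all N in [n s^k , τ n s^k] for some τ > 1
-- independent of k.  If b_n < α, then a_n ≥ n and θ ≥ 1 give
-- (a_n + 1) / (n + 1)^θ < α, so b_N ≤ α for all N in
-- [σ (n + 1) s^k , (n + 1) s^k) for some σ < 1 independent of k.  Both windows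
-- occupy a fixed proportion of the integers below their right end, so a limit
-- of D(x, α) / x would have to be both 0 and 1.  The goal is a negation, hence
-- n with b_n < α or b_n > α and the counts D(x, α) may be assumed to exist.

open import Data.Fin.Base using (Fin)
open import Data.Fin.Subset using (Subset; ∣_∣)
open import Data.Nat.Base using (ℕ; _≤_; _<_)
open import Data.Product.Base using (∃)
open import Relation.Binary.PropositionalEquality using (_≡_)
open import Relation.Nullary using (¬_)
open import Defs

open import Algebra.Bundles using (CommutativeRing)
open import Data.Digit using (Expansion; fromDigits)
open import Data.Empty using (⊥)
open import Data.Fin.Base as Fin using (toℕ; fromℕ<)
import Data.Fin.Properties as Fin
open import Data.Integer.Base as ℤ using (+_; -[1+_])
import Data.Integer.Properties as ℤ
open import Data.List.Base using ([]; _∷_; map)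
open import Data.List.Membership.Propositional using (_∈_)
open import Data.List.Relation.Unary.All as All using ()
open import Data.List.Relation.Unary.AllPairs using ([]; _∷_)
open import Data.List.Relation.Unary.Any using (here; there)
open import Data.Nat.Base as ℕ using (zero; suc)
import Data.Nat.Properties as ℕ
open import Data.Nat.Tactic.RingSolver using (solve-∀)
open import Data.Product.Base using (∃-syntax; _×_; _,_; proj₁; proj₂)
open import Data.Rational.Base as ℚ using (ℚ; 0ℚ; 1ℚ; ↥_; ↧ₙ_)
import Data.Rational.Properties as ℚ
open import Data.Sum.Base using (_⊎_; inj₁; inj₂; [_,_]′; map₁)
open import Function.Base using (it)
open import Function.Bundles using (mk⇔; Equivalence)
open import Relation.Binary.Definitions using (tri<; tri≈; tri>)
open import Relation.Binary.PropositionalEquality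
  using (_≢_; refl; sym; trans; cong; cong₂; subst; subst₂)
open import Relation.Nullary using (yes; no)
open import Relation.Nullary.Negation using (contradiction)

open import Algebra.Properties.CommutativeSemiring.Exp
  (CommutativeRing.commutativeSemiring ℚ.+-*-commutativeRing) as ℚ^
  using (^-assocʳ; ^-distrib-*)

-- Real powers never enter the estimates. A cut for `N ^ θ` supplies rational exponents `x / y` on
-- one side of θ only, so every comparison is raised to a common integer power, and `s ^ θ = p`
-- splits into `s ^ x ≤ p ^ y` and its reverse. The constants τ and σ are rational substitutes for
-- roots, taken from the slack of a strict inequality. The two sides are not symmetric. At the left
-- end of a block the bound `a_N ≥ p^k a_n` loses nothing. The upper bound loses a unit, `a_n + 1`
-- in place of `a_n`, and this is made up only near the right end, where N is close to
-- `(n + 1) s^k`: `(a_n + 1) / a_n ≤ (n + 1) / n ≤ ((n + 1) / n) ^ θ`. Both windows are shrunk to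
-- integer windows `[w s^i , (w + 1) s^i]` with a common scale `s^i`. The density argument then
-- needs the counts at four points only, and the limit itself cancels from their comparison.

module _ where

  open import Relation.Binary.PropositionalEquality using (module ≡-Reasoning)
  open ≡-Reasoning
  open import Data.Rational.Base using (_+_; _*_)

  -- The embedding of ℕ in ℚ.

  fromℕ-+ : ∀ m n → fromℕ (m ℕ.+ n) ≡ fromℕ m + fromℕ n
  fromℕ-+ zero    n = sym (ℚ.+-identityˡ (fromℕ n))
  fromℕ-+ (suc m) n = begin
    fromℕ (suc (m ℕ.+ n))       ≡⟨ fromℕ-suc (m ℕ.+ n) ⟩
    1ℚ + fromℕ (m ℕ.+ n)        ≡⟨ cong (_+_ 1ℚ) (fromℕ-+ m n) ⟩
    1ℚ + (fromℕ m + fromℕ n)    ≡⟨ ℚ.+-assoc 1ℚ (fromℕ m) (fromℕ n) ⟨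
    1ℚ + fromℕ m + fromℕ n      ≡⟨ cong (_+ fromℕ n) (fromℕ-suc m) ⟨
    fromℕ (suc m) + fromℕ n     ∎

  fromℕ-* : ∀ m n → fromℕ (m ℕ.* n) ≡ fromℕ m * fromℕ n
  fromℕ-* zero    n = sym (ℚ.*-zeroˡ (fromℕ n))
  fromℕ-* (suc m) n = begin
    fromℕ (n ℕ.+ m ℕ.* n)               ≡⟨ fromℕ-+ n (m ℕ.* n) ⟩
    fromℕ n + fromℕ (m ℕ.* n)           ≡⟨ cong₂ _+_ (sym (ℚ.*-identityˡ (fromℕ n))) (fromℕ-* m n) ⟩
    1ℚ * fromℕ n + fromℕ m * fromℕ n    ≡⟨ ℚ.*-distribʳ-+ (fromℕ n) 1ℚ (fromℕ m) ⟨
    (1ℚ + fromℕ m) * fromℕ n            ≡⟨ cong (_* fromℕ n) (fromℕ-suc m) ⟨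
    fromℕ (suc m) * fromℕ n             ∎

fromℕ-mono-< : ∀ {m n} → m < n → fromℕ m ℚ.< fromℕ n
fromℕ-mono-< {m} {n} m<n = mk-/-< (+ m) 1 (+ n) 1 (subst₂ ℤ._<_
  (sym (ℤ.*-identityʳ (+ m))) (sym (ℤ.*-identityʳ (+ n))) (ℤ.+<+ m<n))

fromℕ-cancel-≤ : ∀ {m n} → fromℕ m ℚ.≤ fromℕ n → m ≤ n
fromℕ-cancel-≤ {m} {n} h = ℕ.≮⇒≥ λ n<m → ℚ.<-irrefl refl (ℚ.<-≤-trans (fromℕ-mono-< n<m) h)

fromℕ-mono-≤ : ∀ {m n} → m ≤ n → fromℕ m ℚ.≤ fromℕ n
fromℕ-mono-≤ m≤n with ℕ.m≤n⇒m<n∨m≡n m≤n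
... | inj₁ m<n  = ℚ.<⇒≤ (fromℕ-mono-< m<n)
... | inj₂ refl = ℚ.≤-refl

fromℕ-cancel-< : ∀ {m n} → fromℕ m ℚ.< fromℕ n → m < n
fromℕ-cancel-< h = ℕ.≰⇒> λ n≤m → ℚ.<-irrefl refl (ℚ.<-≤-trans h (fromℕ-mono-≤ n≤m))

⊔-least-< : ∀ {x y z} → x ℚ.< z → y ℚ.< z → x ℚ.⊔ y ℚ.< z
⊔-least-< {x} {y} {z} x<z y<z with ℚ.⊔-sel x y
... | inj₁ eq = subst (ℚ._< z) (sym eq) x<z
... | inj₂ eq = subst (ℚ._< z) (sym eq) y<z

fromℕ-^ : ∀ m n → fromℕ (m ℕ.^ n) ≡ fromℕ m ℚ^.^ n
fromℕ-^ m zero    = refl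
fromℕ-^ m (suc n) = trans (fromℕ-* m (m ℕ.^ n)) (cong (fromℕ m ℚ.*_) (fromℕ-^ m n))

-- Powers of rationals and approximate roots.

module _ where

  open ℚ^ using (_^_)
  open import Data.Rational.Base using (_*_)

  ^-monoʳ-≤ : ∀ {b m n} → 1ℚ ℚ.≤ b → m ≤ n → b ^ m ℚ.≤ b ^ n
  ^-monoʳ-≤ {b} 1≤b m≤n = IntegerPower.pow-mono-≤ b 1≤b (ℤ.+≤+ m≤n)

  ^-cancelʳ-≤ : ∀ {b m n} → 1ℚ ℚ.< b → b ^ m ℚ.≤ b ^ n → m ≤ n
  ^-cancelʳ-≤ {b} 1<b h = ℕ.≮⇒≥ λ n<m → ℚ.<-irrefl refl
    (ℚ.<-≤-trans (IntegerPower.pow-mono-< b (ℚ.<⇒≤ 1<b) 1<b (ℤ.+<+ n<m)) h)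

  -- Stands in for an nth root. Splitting `ρ` as `m * (ρ / m)` with both factors below 1 leaves one
  -- factor for each induction step, and the larger of the two bases serves for all of them.
  ^-root : ∀ {ρ} → 0ℚ ℚ.< ρ → ρ ℚ.< 1ℚ → ∀ n → ∃[ σ ] 0ℚ ℚ.< σ × σ ℚ.< 1ℚ × ρ ℚ.≤ σ ^ n
  ^-root {ρ} 0<ρ ρ<1 zero    = ρ , 0<ρ , ρ<1 , ℚ.<⇒≤ ρ<1
  ^-root {ρ} 0<ρ ρ<1 (suc n) with ℚ.<-dense ρ<1
  ... | m , ρ<m , m<1 with ^-root (*-pos 0<ρ (inv-pos 0<m)) ρ/m<1 n
    where
    0<m = ℚ.<-trans 0<ρ ρ<m
    ρ/m<1 : ρ * inv m 0<m ℚ.< 1ℚ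
    ρ/m<1 = subst (ρ * inv m 0<m ℚ.<_) (inv-*ʳ 0<m) (*-mono-<ʳ (inv-pos 0<m) ρ<m)
  ... | σ , 0<σ , σ<1 , h = m ℚ.⊔ σ , 0<μ , ⊔-least-< m<1 σ<1 , (begin
    ρ                          ≡⟨ *-inv-cancel ρ 0<m ⟨
    ρ * inv m 0<m * m          ≡⟨ ℚ.*-comm _ m ⟩
    m * (ρ * inv m 0<m)        ≤⟨ *-mono-≤ˡ (ℚ.<⇒≤ 0<m) h ⟩
    m * σ ^ n                  ≤⟨ *-mono-≤ (ℚ.<⇒≤ 0<m) (ℚ.<⇒≤ (^-pos 0<μ n)) (ℚ.p≤p⊔q m σ)
                                    (^-mono-≤ 0<σ (ℚ.p≤q⊔p m σ) n) ⟩
    (m ℚ.⊔ σ) * (m ℚ.⊔ σ) ^ n  ∎)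
    where
    open ℚ.≤-Reasoning
    0<m = ℚ.<-trans 0<ρ ρ<m
    0<μ = ℚ.<-≤-trans 0<m (ℚ.p≤p⊔q m σ)

-- Comparison with θ-th powers through rational exponents.

-- For θ = log_s p, z ≥ 1 and t > 0: Below z t is t ≤ z ^ (x / y) for some
-- 1 ≤ x / y ≤ θ, and Above z t is z ^ (x / y) ≤ t for some x / y ≥ θ.
module Exponent (s p : ℚ) (1<s : 1ℚ ℚ.< s) (s≤p : s ℚ.≤ p) where

  open ℚ^ using (_^_)
  open import Data.Rational.Base using (_*_)

  Below Above : ℚ → ℚ → Set
  Below z t = ∃[ x ] ∃[ y ] ℕ.NonZero y × y ≤ x × s ^ x ℚ.≤ p ^ y × t ^ y ℚ.≤ z ^ x
  Above z t = ∃[ x ] ∃[ y ] ℕ.NonZero y × p ^ y ℚ.≤ s ^ x × z ^ x ℚ.≤ t ^ y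

  private
    0<s : 0ℚ ℚ.< s
    0<s = ℚ.<-trans 0<1 1<s
    0<p : 0ℚ ℚ.< p
    0<p = ℚ.<-≤-trans 0<s s≤p

    crossing : ∀ {x y x′ y′} → s ^ x ℚ.≤ p ^ y → p ^ y′ ℚ.≤ s ^ x′ → x ℕ.* y′ ≤ x′ ℕ.* y
    crossing {x} {y} {x′} {y′} h h′ = ^-cancelʳ-≤ 1<s (begin
      s ^ (x ℕ.* y′)   ≡⟨ ^-assocʳ s x y′ ⟨
      (s ^ x) ^ y′     ≤⟨ ^-mono-≤ (^-pos 0<s x) h y′ ⟩
      (p ^ y) ^ y′     ≡⟨ ^-comm p y y′ ⟩
      (p ^ y′) ^ y     ≤⟨ ^-mono-≤ (^-pos 0<p y′) h′ y ⟩
      (s ^ x′) ^ y     ≡⟨ ^-assocʳ s x′ y ⟩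
      s ^ (x′ ℕ.* y)   ∎)
      where open ℚ.≤-Reasoning

  module _ (k : ℕ) {z w t r : ℚ} (1≤z : 1ℚ ℚ.≤ z) (0<t : 0ℚ ℚ.< t) (0<r : 0ℚ ℚ.< r) where

    private
      0<z = ℚ.<-≤-trans 0<1 1≤z
      0<sᵏz = *-pos (^-pos 0<s k) 0<z

    -- Rational form of `p^k z^θ = (s^k z)^θ ≤ w^θ`. After raising to the power `y y′`, the exponent
    -- of `z` may be enlarged from `x / y` to `x′ / y′`, since these lie on either side of θ and
    -- `z ≥ 1`. The factor `p^k` is bounded through the upper exponent `x′ / y′`.
    below⇒≤above : Below z t → Above w r → s ^ k * z ℚ.≤ w → p ^ k * t ℚ.≤ r
    below⇒≤above (x , y , y≢0 , _ , sˣ≤ , t≤) (x′ , y′ , y′≢0 , ≤sˣ , ≤r) sᵏz≤w =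
      ^-cancel-≤ 0<r y {{y≢0}} (^-cancel-≤ (^-pos 0<r y) y′ {{y′≢0}} (begin
        ((p ^ k * t) ^ y) ^ y′              ≡⟨ ^-assocʳ (p ^ k * t) y y′ ⟩
        (p ^ k * t) ^ (y ℕ.* y′)            ≡⟨ ^-distrib-* (p ^ k) t (y ℕ.* y′) ⟩
        (p ^ k) ^ (y ℕ.* y′) * t ^ (y ℕ.* y′)
          ≤⟨ *-mono-≤ (ℚ.<⇒≤ (^-pos (^-pos 0<p k) (y ℕ.* y′))) (ℚ.<⇒≤ (^-pos 0<z (x′ ℕ.* y))) scale (begin
            t ^ (y ℕ.* y′)     ≡⟨ ^-assocʳ t y y′ ⟨
            (t ^ y) ^ y′       ≤⟨ ^-mono-≤ (^-pos 0<t y) t≤ y′ ⟩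
            (z ^ x) ^ y′       ≡⟨ ^-assocʳ z x y′ ⟩
            z ^ (x ℕ.* y′)     ≤⟨ ^-monoʳ-≤ 1≤z (crossing {x} {y} {x′} {y′} sˣ≤ ≤sˣ) ⟩
            z ^ (x′ ℕ.* y)     ∎) ⟩
        (s ^ k) ^ (x′ ℕ.* y) * z ^ (x′ ℕ.* y)
                                            ≡⟨ ^-distrib-* (s ^ k) z (x′ ℕ.* y) ⟨
        (s ^ k * z) ^ (x′ ℕ.* y)            ≤⟨ ^-mono-≤ 0<sᵏz sᵏz≤w (x′ ℕ.* y) ⟩
        w ^ (x′ ℕ.* y)                      ≡⟨ ^-assocʳ w x′ y ⟨
        (w ^ x′) ^ y                        ≤⟨ ^-mono-≤ (^-pos (ℚ.<-≤-trans 0<sᵏz sᵏz≤w) x′) ≤r y ⟩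
        (r ^ y′) ^ y                        ≡⟨ ^-comm r y′ y ⟩
        (r ^ y) ^ y′                        ∎))
      where
      open ℚ.≤-Reasoning
      scale : (p ^ k) ^ (y ℕ.* y′) ℚ.≤ (s ^ k) ^ (x′ ℕ.* y)
      scale = begin
        (p ^ k) ^ (y ℕ.* y′)   ≡⟨ cong ((p ^ k) ^_) (ℕ.*-comm y y′) ⟩
        (p ^ k) ^ (y′ ℕ.* y)   ≡⟨ ^-comm p k (y′ ℕ.* y) ⟩
        (p ^ (y′ ℕ.* y)) ^ k   ≡⟨ cong (_^ k) (^-assocʳ p y′ y) ⟨
        ((p ^ y′) ^ y) ^ k     ≤⟨ ^-mono-≤ (^-pos (^-pos 0<p y′) y) (^-mono-≤ (^-pos 0<p y′) ≤sˣ y) k ⟩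
        ((s ^ x′) ^ y) ^ k     ≡⟨ cong (_^ k) (^-assocʳ s x′ y) ⟩
        (s ^ (x′ ℕ.* y)) ^ k   ≡⟨ ^-comm s (x′ ℕ.* y) k ⟩
        (s ^ k) ^ (x′ ℕ.* y)   ∎

    -- The dual estimate `w^θ ≤ p^k z^θ`. Now `s^k` is bounded through the lower exponent `x / y`,
    -- while the exponent of `z` is again enlarged to `x′ / y′`.
    below≤⇒above : Above z r → Below w t → 0ℚ ℚ.< w → w ℚ.≤ s ^ k * z → t ℚ.≤ p ^ k * r
    below≤⇒above (x′ , y′ , y′≢0 , ≤sˣ , ≤r) (x , y , y≢0 , _ , sˣ≤ , t≤) 0<w w≤sᵏz =
      ^-cancel-≤ 0<pᵏr y {{y≢0}} (^-cancel-≤ (^-pos 0<pᵏr y) y′ {{y′≢0}} (begin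
        (t ^ y) ^ y′                            ≤⟨ ^-mono-≤ (^-pos 0<t y) t≤ y′ ⟩
        (w ^ x) ^ y′                            ≡⟨ ^-assocʳ w x y′ ⟩
        w ^ (x ℕ.* y′)                          ≤⟨ ^-mono-≤ 0<w w≤sᵏz (x ℕ.* y′) ⟩
        (s ^ k * z) ^ (x ℕ.* y′)                ≡⟨ ^-distrib-* (s ^ k) z (x ℕ.* y′) ⟩
        (s ^ k) ^ (x ℕ.* y′) * z ^ (x ℕ.* y′)
          ≤⟨ *-mono-≤ (ℚ.<⇒≤ (^-pos (^-pos 0<s k) (x ℕ.* y′))) (ℚ.<⇒≤ (^-pos 0<r (y ℕ.* y′))) scale (begin
            z ^ (x ℕ.* y′)     ≤⟨ ^-monoʳ-≤ 1≤z (crossing {x} {y} {x′} {y′} sˣ≤ ≤sˣ) ⟩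
            z ^ (x′ ℕ.* y)     ≡⟨ ^-assocʳ z x′ y ⟨
            (z ^ x′) ^ y       ≤⟨ ^-mono-≤ (^-pos 0<z x′) ≤r y ⟩
            (r ^ y′) ^ y       ≡⟨ ^-comm r y′ y ⟩
            (r ^ y) ^ y′       ≡⟨ ^-assocʳ r y y′ ⟩
            r ^ (y ℕ.* y′)     ∎) ⟩
        (p ^ k) ^ (y ℕ.* y′) * r ^ (y ℕ.* y′)   ≡⟨ ^-distrib-* (p ^ k) r (y ℕ.* y′) ⟨
        (p ^ k * r) ^ (y ℕ.* y′)                ≡⟨ ^-assocʳ (p ^ k * r) y y′ ⟨
        ((p ^ k * r) ^ y) ^ y′                  ∎))
      where
      open ℚ.≤-Reasoning
      0<pᵏr = *-pos (^-pos 0<p k) 0<r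
      scale : (s ^ k) ^ (x ℕ.* y′) ℚ.≤ (p ^ k) ^ (y ℕ.* y′)
      scale = begin
        (s ^ k) ^ (x ℕ.* y′)   ≡⟨ ^-comm s k (x ℕ.* y′) ⟩
        (s ^ (x ℕ.* y′)) ^ k   ≡⟨ cong (_^ k) (^-assocʳ s x y′) ⟨
        ((s ^ x) ^ y′) ^ k     ≤⟨ ^-mono-≤ (^-pos (^-pos 0<s x) y′) (^-mono-≤ (^-pos 0<s x) sˣ≤ y′) k ⟩
        ((p ^ y) ^ y′) ^ k     ≡⟨ cong (_^ k) (^-assocʳ p y y′) ⟩
        (p ^ (y ℕ.* y′)) ^ k   ≡⟨ ^-comm p (y ℕ.* y′) k ⟩
        (p ^ k) ^ (y ℕ.* y′)   ∎

  below-mono : ∀ {z w t} → 0ℚ ℚ.< z → z ℚ.≤ w → Below z t → Below w t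
  below-mono 0<z z≤w (x , y , y≢0 , y≤x , sˣ≤ , t≤) =
    x , y , y≢0 , y≤x , sˣ≤ , ℚ.≤-trans t≤ (^-mono-≤ 0<z z≤w x)

  -- Rests on `ρ ≤ ρ^θ`, that is on θ ≥ 1; the clause `y ≤ x` of `Below` is there for this step.
  below-dilate : ∀ {ρ z t} → 1ℚ ℚ.≤ ρ → 0ℚ ℚ.< t → Below z t → Below (ρ * z) (ρ * t)
  below-dilate {ρ} {z} {t} 1≤ρ 0<t (x , y , y≢0 , y≤x , sˣ≤ , t≤) = x , y , y≢0 , y≤x , sˣ≤ , (begin
    (ρ * t) ^ y     ≡⟨ ^-distrib-* ρ t y ⟩
    ρ ^ y * t ^ y   ≤⟨ *-mono-≤ (ℚ.<⇒≤ (^-pos 0<ρ y)) (ℚ.<⇒≤ (ℚ.<-≤-trans (^-pos 0<t y) t≤))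
                         (^-monoʳ-≤ 1≤ρ y≤x) t≤ ⟩
    ρ ^ x * z ^ x   ≡⟨ ^-distrib-* ρ z x ⟨
    (ρ * z) ^ x     ∎)
    where
    open ℚ.≤-Reasoning
    0<ρ = ℚ.<-≤-trans 0<1 1≤ρ

  private
    -- A rational substitute for `σ = (c / t) ^ (y / x)`. It is enough that `σ ^ x` dominates
    -- `c / t` itself, because `(c / t) ^ y ≤ c / t`.
    ^-ratio : ∀ {c t x} y → ℕ.NonZero y → 0ℚ ℚ.< c → c ℚ.< t →
              ∃[ σ ] 0ℚ ℚ.< σ × σ ℚ.< 1ℚ × c ^ y ℚ.≤ σ ^ x * t ^ y
    ^-ratio {c} {t} {x} y y≢0 0<c c<t = bound (^-root 0<ρ ρ<1 x)
      where
      open ℚ.≤-Reasoning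
      0<t = ℚ.<-trans 0<c c<t
      ρ = c * inv t 0<t
      0<ρ = *-pos 0<c (inv-pos 0<t)
      ρ<1 : ρ ℚ.< 1ℚ
      ρ<1 = subst (ρ ℚ.<_) (inv-*ʳ 0<t) (*-mono-<ʳ (inv-pos 0<t) c<t)
      bound : ∃[ σ ] 0ℚ ℚ.< σ × σ ℚ.< 1ℚ × ρ ℚ.≤ σ ^ x →
              ∃[ σ ] 0ℚ ℚ.< σ × σ ℚ.< 1ℚ × c ^ y ℚ.≤ σ ^ x * t ^ y
      bound (σ , 0<σ , σ<1 , ρ≤σˣ) = σ , 0<σ , σ<1 , (begin
        c ^ y           ≡⟨ cong (_^ y) (*-inv-cancel c 0<t) ⟨
        (ρ * t) ^ y     ≡⟨ ^-distrib-* ρ t y ⟩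
        ρ ^ y * t ^ y   ≤⟨ *-mono-≤ (ℚ.<⇒≤ (^-pos 0<ρ y)) (ℚ.<⇒≤ (^-pos 0<t y))
                             (ℚ.≤-trans (p^n≤p 0<ρ (ℚ.<⇒≤ ρ<1) y {{y≢0}}) ρ≤σˣ) ℚ.≤-refl ⟩
        σ ^ x * t ^ y   ∎)

  -- Trades slack in the value for slack in the base; this produces the σ of the lower window, as
  -- `above-grow` produces the τ of the upper one.
  below-shrink : ∀ {z t c} → 0ℚ ℚ.< c → c ℚ.< t → Below z t →
                 ∃[ σ ] 0ℚ ℚ.< σ × σ ℚ.< 1ℚ × Below (σ * z) c
  below-shrink {z} {t} {c} 0<c c<t (x , y , y≢0 , y≤x , sˣ≤ , t≤) =
    shrink (^-ratio {x = x} y y≢0 0<c c<t)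
    where
    open ℚ.≤-Reasoning
    shrink : ∃[ σ ] 0ℚ ℚ.< σ × σ ℚ.< 1ℚ × c ^ y ℚ.≤ σ ^ x * t ^ y →
             ∃[ σ ] 0ℚ ℚ.< σ × σ ℚ.< 1ℚ × Below (σ * z) c
    shrink (σ , 0<σ , σ<1 , c≤) = σ , 0<σ , σ<1 , x , y , y≢0 , y≤x , sˣ≤ , (begin
      c ^ y           ≤⟨ c≤ ⟩
      σ ^ x * t ^ y   ≤⟨ *-mono-≤ˡ (ℚ.<⇒≤ (^-pos 0<σ x)) t≤ ⟩
      σ ^ x * z ^ x   ≡⟨ ^-distrib-* σ z x ⟨
      (σ * z) ^ x     ∎)

  above-grow : ∀ {z r c} → 0ℚ ℚ.< z → 0ℚ ℚ.< r → r ℚ.< c → Above z r →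
               ∃[ τ ] 1ℚ ℚ.< τ × Above (τ * z) c
  above-grow {z} {r} {c} 0<z 0<r r<c (x , y , y≢0 , ≤sˣ , ≤r) =
    grow (^-ratio {x = x} y y≢0 0<r r<c)
    where
    open ℚ.≤-Reasoning
    0<cʸ = ^-pos (ℚ.<-trans 0<r r<c) y
    grow : ∃[ σ ] 0ℚ ℚ.< σ × σ ℚ.< 1ℚ × r ^ y ℚ.≤ σ ^ x * c ^ y →
           ∃[ τ ] 1ℚ ℚ.< τ × Above (τ * z) c
    grow (σ , 0<σ , σ<1 , r≤) = τ , 1<τ , x , y , y≢0 , ≤sˣ , (begin
      (τ * z) ^ x                   ≡⟨ ^-distrib-* τ z x ⟩
      τ ^ x * z ^ x                 ≤⟨ *-mono-≤ˡ (ℚ.<⇒≤ (^-pos 0<τ x)) (ℚ.≤-trans ≤r r≤) ⟩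
      τ ^ x * (σ ^ x * c ^ y)       ≡⟨ ℚ.*-assoc (τ ^ x) (σ ^ x) (c ^ y) ⟨
      τ ^ x * σ ^ x * c ^ y         ≡⟨ cong (_* c ^ y) (^-distrib-* τ σ x) ⟨
      (τ * σ) ^ x * c ^ y           ≡⟨ cong (λ q → q ^ x * c ^ y) (inv-*ˡ 0<σ) ⟩
      1ℚ ^ x * c ^ y                ≤⟨ *-mono-≤ (ℚ.<⇒≤ (^-pos 0<1 x)) (ℚ.<⇒≤ 0<cʸ) (^≤1 0<1 ℚ.≤-refl x) ℚ.≤-refl ⟩
      1ℚ * c ^ y                    ≡⟨ ℚ.*-identityˡ (c ^ y) ⟩
      c ^ y                         ∎)
      where
      τ = inv σ 0<σ
      0<τ = inv-pos 0<σ
      1<τ : 1ℚ ℚ.< τ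
      1<τ = subst₂ ℚ._<_ (inv-*ʳ 0<σ) (ℚ.*-identityˡ τ) (*-mono-<ʳ 0<τ σ<1)

-- From the cuts of `log` and `rpow` to natural exponents.

module _ (b : ℚ) (1≤b : 1ℚ ℚ.≤ b) where

  open ℚ^ using (_^_)
  open IntegerPower b 1≤b

  -- The cuts of `log` carry a witness strictly beyond the rational in question; this lemma and the
  -- next move the inequality back to that rational.
  b^≤-closed : ∀ {q r t} → 0ℚ ℚ.< t → q ℚ.< r → b^ r ≤ t → b^ q ≤ t
  b^≤-closed {q} {r} {t} 0<t q<r h = ^-cancel-≤ (^-pos 0<t v) w (begin
    pow (↥ q) ^ w         ≡⟨ pow-* (↥ q) w ⟨
    pow (↥ q ℤ.* + w)     ≤⟨ pow-mono-≤ (ℚ.drop-*≤* (ℚ.<⇒≤ q<r)) ⟩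
    pow (↥ r ℤ.* + v)     ≡⟨ pow-* (↥ r) v ⟩
    pow (↥ r) ^ v         ≤⟨ ^-mono-≤ (pow-pos (↥ r)) h v ⟩
    (t ^ w) ^ v           ≡⟨ ^-comm t w v ⟩
    (t ^ v) ^ w           ∎)
    where
    open ℚ.≤-Reasoning
    v = ↧ₙ q
    w = ↧ₙ r

  ≤b^-closed : ∀ {q r t} → 0ℚ ℚ.< t → q ℚ.< r → t ≤b^ q → t ≤b^ r
  ≤b^-closed {q} {r} {t} 0<t q<r h = ^-cancel-≤ (pow-pos (↥ r)) v (begin
    (t ^ w) ^ v           ≡⟨ ^-comm t w v ⟩
    (t ^ v) ^ w           ≤⟨ ^-mono-≤ (^-pos 0<t v) h w ⟩
    pow (↥ q) ^ w         ≡⟨ pow-* (↥ q) w ⟨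
    pow (↥ q ℤ.* + w)     ≤⟨ pow-mono-≤ (ℚ.drop-*≤* (ℚ.<⇒≤ q<r)) ⟩
    pow (↥ r ℤ.* + v)     ≡⟨ pow-* (↥ r) v ⟩
    pow (↥ r) ^ v         ∎)
    where
    open ℚ.≤-Reasoning
    v = ↧ₙ q
    w = ↧ₙ r

module _ {s p : ℚ} (1<s : 1ℚ ℚ.< s) (s≤p : s ℚ.≤ p) (1≤p : 1ℚ ℚ.≤ p)
         {z : ℚ} (1≤z : 1ℚ ℚ.≤ z) where

  open ℚ^ using (_^_)
  open Exponent s p 1<s s≤p
  open IntegerPower using (pow; pow-mono-≤; pow-mono-<)

  private
    1≤s = ℚ.<⇒≤ 1<s
    0<s = ℚ.<-trans 0<1 1<s
    θ = log s p 1<s 1≤p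

  lower⇒below : ∀ {c} → 0ℚ ℚ.< c → ℝ.Lower (rpow z 1≤z θ) c → Below z c
  lower⇒below {c} 0<c (r , t , (f , r<f , s^f≤p) , 0<t , c<t , t≤z^r) =
    convert (↥ r) (↧ₙ r) (b^≤-closed s 1≤s {r} {f} (ℚ.<-≤-trans 0<1 1≤p) r<f s^f≤p)
      (ℚ.≤-trans (^-mono-≤ 0<c (ℚ.<⇒≤ c<t) (↧ₙ r)) t≤z^r)
    where
    convert : ∀ i y .{{_ : ℕ.NonZero y}} → pow s 1≤s i ℚ.≤ p ^ y → c ^ y ℚ.≤ pow z 1≤z i → Below z c
    convert i y@(suc _) sⁱ≤ ≤zⁱ with i ℤ.≤? + y
    -- An exponent `i / y` that is at most 1, perhaps negative, is replaced by `y / y`: it stays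
    -- admissible because `s ≤ p`, and `z ≥ 1` keeps the bound on `c`.
    ... | yes i≤y = y , y , _ , ℕ.≤-refl , ^-mono-≤ 0<s s≤p y , ℚ.≤-trans ≤zⁱ (pow-mono-≤ z 1≤z i≤y)
    convert (+ x)    y@(suc _) sⁱ≤ ≤zⁱ | no i≰y = x , y , _ , ℤ.drop‿+≤+ (ℤ.<⇒≤ (ℤ.≰⇒> i≰y)) , sⁱ≤ , ≤zⁱ
    convert -[1+ _ ] y@(suc _) sⁱ≤ ≤zⁱ | no i≰y = contradiction ℤ.-≤+ i≰y

  upper⇒above : ∀ {c} → ℝ.Upper (rpow z 1≤z θ) c → Above z c
  upper⇒above {c} (r , t , (f , f<r , p≤s^f) , 0<t , t<c , z^r≤t) =
    convert (↥ r) (↧ₙ r) (≤b^-closed s 1≤s {f} {r} (ℚ.<-≤-trans 0<1 1≤p) f<r p≤s^f)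
      (ℚ.≤-trans z^r≤t (^-mono-≤ 0<t (ℚ.<⇒≤ t<c) (↧ₙ r)))
    where
    convert : ∀ i y .{{_ : ℕ.NonZero y}} → p ^ y ℚ.≤ pow s 1≤s i → pow z 1≤z i ℚ.≤ c ^ y → Above z c
    convert (+ x)    y@(suc _) ≤sⁱ zⁱ≤ = x , y , _ , ≤sⁱ , zⁱ≤
    -- A negative exponent cannot lie above θ: it would give `1 ≤ p ^ y ≤ s ^ i < 1`.
    convert -[1+ n ] y         ≤sⁱ _   = contradiction
      (ℚ.≤-<-trans (1≤^ 1≤p y) (ℚ.≤-<-trans ≤sⁱ (pow-mono-< s 1≤s { -[1+ n ]} {+ 0} 1<s ℤ.-<+)))
      (ℚ.<-irrefl refl)

-- Base-s expansions and their uniqueness.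

module _ where

  open import Data.Nat.Base using (_+_; _*_)
  open ℕ.≤-Reasoning

  lex-< : ∀ {s d m n} e → d < s → m < n → d + m * s < e + n * s
  lex-< {s} {d} {m} {n} e d<s m<n = begin-strict
    d + m * s  <⟨ ℕ.+-monoˡ-< (m * s) d<s ⟩
    suc m * s  ≤⟨ ℕ.*-monoˡ-≤ s m<n ⟩
    n * s      ≤⟨ ℕ.m≤n+m (n * s) e ⟩
    e + n * s  ∎

  lex-injective : ∀ {s d e} m n → d < s → e < s → d + m * s ≡ e + n * s → d ≡ e × m ≡ n
  lex-injective {s} {d} {e} m n d<s e<s eq with ℕ.<-cmp m n
  ... | tri< m<n _ _  = contradiction eq (ℕ.<⇒≢ (lex-< e d<s m<n))
  ... | tri≈ _ refl _ = ℕ.+-cancelʳ-≡ (m * s) d e eq , refl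
  ... | tri> _ _ n<m  = contradiction (sym eq) (ℕ.<⇒≢ (lex-< d e<s n<m))

Canonical : ∀ {s} → Expansion s → Set
Canonical ds = ds ≡ [] ⊎ LeadingNonZero ds

tail-canonical : ∀ {s d} {ds : Expansion s} → LeadingNonZero (d ∷ ds) → Canonical ds
tail-canonical [ _ ]    = inj₁ refl
tail-canonical (_ ∷ nz) = inj₂ nz

leading⇒positive : ∀ {s} {ds : Expansion s} → LeadingNonZero ds → 0 < fromDigits ds
leading⇒positive {_} {d ∷ []}     [ d≢0 ]  = ℕ.<-≤-trans (ℕ.n≢0⇒n>0 d≢0) (ℕ.m≤m+n (toℕ d) _)
leading⇒positive {suc _} {d ∷ ds} (_ ∷ nz) =
  ℕ.<-≤-trans (ℕ.*-mono-< (leading⇒positive nz) ℕ.z<s) (ℕ.m≤n+m _ (toℕ d))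

canonical-unique : ∀ {s} {ds es : Expansion s} → Canonical ds → Canonical es →
                   fromDigits ds ≡ fromDigits es → ds ≡ es
canonical-unique (inj₁ refl) (inj₁ refl) _  = refl
canonical-unique (inj₁ refl) (inj₂ nz)   eq = contradiction eq (ℕ.<⇒≢ (leading⇒positive nz))
canonical-unique (inj₂ nz)   (inj₁ refl) eq = contradiction (sym eq) (ℕ.<⇒≢ (leading⇒positive nz))
canonical-unique {_} {d ∷ ds} {e ∷ es} (inj₂ nz) (inj₂ nz′) eq
  with lex-injective (fromDigits ds) (fromDigits es) (Fin.toℕ<n d) (Fin.toℕ<n e) eq
... | d≡e , eq′ = cong₂ _∷_ (Fin.toℕ-injective d≡e)
  (canonical-unique (tail-canonical nz) (tail-canonical nz′) eq′)

-- Growth of the digit substitution on blocks.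

module Digits (p s : ℕ) (2≤s : 2 ≤ s) (s<p : s < p) (h : Fin s → Fin p)
              (increasing : ∀ {i j} → i Fin.< j → h i Fin.< h j) where

  open import Data.Nat.Base using (_+_; _*_; _^_)
  open DigitSequence p s 2≤s s<p h using (a)

  0<s : 0 < s
  0<s = ℕ.<-≤-trans ℕ.z<s 2≤s

  toℕ≤h : ∀ i → toℕ i ≤ toℕ (h i)
  toℕ≤h i = subst (λ j → toℕ i ≤ toℕ (h j)) (Fin.fromℕ<-toℕ i (Fin.toℕ<n i)) (bound (toℕ i) (Fin.toℕ<n i))
    where
    bound : ∀ n (n<s : n < s) → n ≤ toℕ (h (fromℕ< n<s))
    bound zero    _     = ℕ.z≤n
    bound (suc n) 1+n<s = ℕ.≤-<-trans (bound n n<s) (increasing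
      (subst₂ _<_ (sym (Fin.toℕ-fromℕ< n<s)) (sym (Fin.toℕ-fromℕ< 1+n<s)) (ℕ.n<1+n n)))
      where n<s = ℕ.<-trans (ℕ.n<1+n n) 1+n<s

  fromDigits≤map : ∀ ds → fromDigits ds ≤ fromDigits (map h ds)
  fromDigits≤map []       = ℕ.z≤n
  fromDigits≤map (d ∷ ds) = ℕ.+-mono-≤ (toℕ≤h d) (ℕ.*-mono-≤ (fromDigits≤map ds) (ℕ.<⇒≤ s<p))

  -- The most significant differing digit decides on both sides. Equal tails must coincide as lists,
  -- so that the comparison passes to the lowest digit. Expansions of different lengths end at an
  -- empty list, whose image 0 lies below the positive image of the other.
  map-mono-< : ∀ {ds es} → Canonical ds → Canonical es → fromDigits ds < fromDigits es →
               fromDigits (map h ds) < fromDigits (map h es)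
  map-mono-< {es = es} (inj₁ refl) _ 0<es = ℕ.<-≤-trans 0<es (fromDigits≤map es)
  map-mono-< (inj₂ _) (inj₁ refl) ()
  map-mono-< {d ∷ ds} {e ∷ es} (inj₂ nz) (inj₂ nz′) d∷ds<e∷es
    with ℕ.<-cmp (fromDigits ds) (fromDigits es)
  ... | tri< ds<es _ _ = lex-< (toℕ (h e)) (Fin.toℕ<n (h d))
    (map-mono-< (tail-canonical nz) (tail-canonical nz′) ds<es)
  ... | tri> _ _ es<ds = contradiction d∷ds<e∷es (ℕ.<-asym (lex-< (toℕ d) (Fin.toℕ<n e) es<ds))
  ... | tri≈ _ eq _ with canonical-unique (tail-canonical nz) (tail-canonical nz′) eq
  ...   | refl = ℕ.+-monoˡ-< _ (increasing (ℕ.+-cancelʳ-< _ (toℕ d) (toℕ e) d∷ds<e∷es))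

  digits : ∀ n → ∃[ ds ] fromDigits {s} ds ≡ n × Canonical ds
  digits zero      = [] , refl , inj₁ refl
  digits n@(suc _) with expansion s 2≤s n
  ... | ds , eq , nz = ds , eq , inj₂ nz

  -- `a` extended by the value 0 at 0, which removes the instance argument from monotonicity and
  -- rewriting.
  a₀ : ℕ → ℕ
  a₀ n = fromDigits (map h (proj₁ (digits n)))

  a≡a₀ : ∀ n .{{_ : ℕ.NonZero n}} → a n ≡ a₀ n
  a≡a₀ (suc _) = refl

  n≤a₀ : ∀ n → n ≤ a₀ n
  n≤a₀ n = subst (_≤ a₀ n) (proj₁ (proj₂ (digits n))) (fromDigits≤map (proj₁ (digits n)))

  a₀-mono-< : ∀ {m n} → m < n → a₀ m < a₀ n
  a₀-mono-< {m} {n} m<n with digits m | digits n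
  ... | _ , refl , can | _ , refl , can′ = map-mono-< can can′ m<n

  a₀-mono-≤ : ∀ {m n} → m ≤ n → a₀ m ≤ a₀ n
  a₀-mono-≤ m≤n with ℕ.m≤n⇒m<n∨m≡n m≤n
  ... | inj₁ m<n  = ℕ.<⇒≤ (a₀-mono-< m<n)
  ... | inj₂ refl = ℕ.≤-refl

  a₀-canonical : ∀ {ds} → Canonical ds → a₀ (fromDigits ds) ≡ fromDigits (map h ds)
  a₀-canonical {ds} can with digits (fromDigits ds)
  ... | _ , eq , can′ = cong (λ ds → fromDigits (map h ds)) (canonical-unique can′ can eq)

  -- The case `n = 0` is excluded because for `d = 0` the left side is 0, whereas `h` may send 0 to
  -- a nonzero digit.
  a₀-append : ∀ d n .{{_ : ℕ.NonZero n}} → a₀ (toℕ d + n * s) ≡ toℕ (h d) + a₀ n * p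
  a₀-append d n with digits n
  ... | ds , eq , inj₂ nz = trans (cong (λ m → a₀ (toℕ d + m * s)) (sym eq))
    (a₀-canonical {d ∷ ds} (inj₂ (d ∷ nz)))
  ... | _ , eq , inj₁ refl = contradiction (sym eq) (ℕ.≢-nonZero⁻¹ n)

  a₀-lower : ∀ k q .{{_ : ℕ.NonZero q}} → ∀ {n} → q * s ^ k ≤ n → a₀ q * p ^ k ≤ a₀ n
  a₀-lower k q le = ℕ.≤-trans (zeros k) (a₀-mono-≤ le)
    where
    open ℕ.≤-Reasoning
    instance
      s≢0 : ℕ.NonZero s
      s≢0 = ℕ.>-nonZero 0<s
    0d : Fin s
    0d = fromℕ< 0<s
    -- Only an inequality: every appended zero contributes the value of `h` at 0, which may be
    -- positive.
    zeros : ∀ k → a₀ q * p ^ k ≤ a₀ (q * s ^ k)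
    zeros zero    = ℕ.≤-reflexive (trans (ℕ.*-identityʳ (a₀ q)) (cong a₀ (sym (ℕ.*-identityʳ q))))
    zeros (suc k) = begin
      a₀ q * (p * p ^ k)                 ≡⟨ cong (a₀ q *_) (ℕ.*-comm p (p ^ k)) ⟩
      a₀ q * (p ^ k * p)                 ≡⟨ ℕ.*-assoc (a₀ q) (p ^ k) p ⟨
      a₀ q * p ^ k * p                   ≤⟨ ℕ.*-monoˡ-≤ p (zeros k) ⟩
      a₀ (q * s ^ k) * p                 ≤⟨ ℕ.m≤n+m _ (toℕ (h 0d)) ⟩
      toℕ (h 0d) + a₀ (q * s ^ k) * p    ≡⟨ a₀-append 0d (q * s ^ k) {{ℕ.m*n≢0 q (s ^ k) {{it}} {{ℕ.m^n≢0 s k}}}} ⟨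
      a₀ (toℕ 0d + q * s ^ k * s)        ≡⟨ cong (λ z → a₀ (z + q * s ^ k * s)) (Fin.toℕ-fromℕ< 0<s) ⟩
      a₀ (q * s ^ k * s)                 ≡⟨ cong a₀ (ℕ.*-assoc q (s ^ k) s) ⟩
      a₀ (q * (s ^ k * s))               ≡⟨ cong (λ z → a₀ (q * z)) (ℕ.*-comm (s ^ k) s) ⟩
      a₀ (q * (s * s ^ k))               ∎

  a₀-upper : ∀ k q .{{_ : ℕ.NonZero q}} → ∀ {n} → n < suc q * s ^ k → a₀ n < suc (a₀ q) * p ^ k
  a₀-upper k q {n} n<top with top k
    where
    open ℕ.≤-Reasoning
    1+pred : suc (ℕ.pred s) ≡ s
    1+pred = ℕ.suc-pred s {{ℕ.>-nonZero 0<s}}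
    last : ∃[ d ] suc (toℕ {s} d) ≡ s
    last = fromℕ< (ℕ.≤-reflexive 1+pred) , trans (cong suc (Fin.toℕ-fromℕ< _)) 1+pred
    -- Here `m` is `q` followed by k digits `s - 1`, the last integer of the block. Each image digit
    -- is at most `p - 1`, so `a₀ m + 1` grows by a factor of at most p per digit.
    top : ∀ k → ∃[ m ] ℕ.NonZero m × suc m ≡ suc q * s ^ k × suc (a₀ m) ≤ suc (a₀ q) * p ^ k
    top zero    = q , ℕ.≢-nonZero (ℕ.≢-nonZero⁻¹ q) , sym (ℕ.*-identityʳ (suc q)) ,
                  ℕ.≤-reflexive (sym (ℕ.*-identityʳ _))
    top (suc k) with last | top k
    ... | d , d≡ | m , m≢0 , m≡ , a₀m< = toℕ d + m * s ,
      ℕ.>-nonZero (ℕ.<-≤-trans (ℕ.*-mono-< (ℕ.>-nonZero⁻¹ m {{m≢0}}) 0<s) (ℕ.m≤n+m _ (toℕ d))) ,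
      (begin-equality
        suc (toℕ d) + m * s   ≡⟨ cong (_+ m * s) d≡ ⟩
        suc m * s             ≡⟨ cong (_* s) m≡ ⟩
        suc q * s ^ k * s     ≡⟨ rotate (suc q) (s ^ k) s ⟩
        suc q * (s * s ^ k)   ∎) ,
      (begin
        suc (a₀ (toℕ d + m * s))        ≡⟨ cong suc (a₀-append d m {{m≢0}}) ⟩
        suc (toℕ (h d)) + a₀ m * p      ≤⟨ ℕ.+-monoˡ-≤ (a₀ m * p) (Fin.toℕ<n (h d)) ⟩
        suc (a₀ m) * p                  ≤⟨ ℕ.*-monoˡ-≤ p a₀m< ⟩
        suc (a₀ q) * p ^ k * p          ≡⟨ rotate (suc (a₀ q)) (p ^ k) p ⟩
        suc (a₀ q) * (p * p ^ k)        ∎)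
      where
      rotate : ∀ x y z → x * y * z ≡ x * (z * y)
      rotate x y z = trans (ℕ.*-assoc x y z) (cong (x *_) (ℕ.*-comm y z))
  ... | m , _ , m≡ , a₀m< = ℕ.≤-<-trans (a₀-mono-≤ (ℕ.≤-pred (subst (suc n ≤_) (sym m≡) n<top))) a₀m<

-- The counting function at integers.

≤⇒≤ᵣ : ∀ m n → m ≤ n → fromℚ (fromℕ m) ≤ᵣ fromℚ (fromℕ n)
≤⇒≤ᵣ _ _ m≤n (q , n<q , q<m) = ℚ.<-irrefl refl
  (ℚ.<-≤-trans (ℚ.<-trans n<q q<m) (fromℕ-mono-≤ m≤n))

≤ᵣ⇒≤ : ∀ m n → fromℚ (fromℕ m) ≤ᵣ fromℚ (fromℕ n) → m ≤ n
≤ᵣ⇒≤ _ _ m≤n = ℕ.≮⇒≥ λ n<m → m≤n (ℚ.<-dense (fromℕ-mono-< n<m))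

module Counting (b : Sequence) (α : ℝ) where

  Counted : ℕ → Set
  Counted n = ∃ λ (n≢0 : ℕ.NonZero n) → b n {{n≢0}} ≤ᵣ α

  Count : ℕ → ℕ → Set
  Count N = D b (fromℚ (fromℕ N)) α

  count-zero : Count 0 0
  count-zero = [] , [] , (λ n → mk⇔ (λ ())
    λ { (n≢0 , n≤0 , _) → contradiction (ℕ.n≤0⇒n≡0 (≤ᵣ⇒≤ n 0 n≤0)) (ℕ.≢-nonZero⁻¹ n {{n≢0}}) }) , refl

  private
    InRange : ℕ → ℕ → Set
    InRange N n = ∃ λ (n≢0 : ℕ.NonZero n) → fromℚ (fromℕ n) ≤ᵣ fromℚ (fromℕ N) × b n {{n≢0}} ≤ᵣ α

    inRange⇒≤ : ∀ {N n} → InRange N n → n ≤ N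
    inRange⇒≤ {N} {n} (_ , n≤N , _) = ≤ᵣ⇒≤ n N n≤N

    inRange : ∀ {N n} → n ≤ N → Counted n → InRange N n
    inRange {N} {n} n≤N (n≢0 , bn≤α) = n≢0 , ≤⇒≤ᵣ n N n≤N , bn≤α

    inRange⇒counted : ∀ {N n} → InRange N n → Counted n
    inRange⇒counted (n≢0 , _ , bn≤α) = n≢0 , bn≤α

    inRange-suc : ∀ {N n} → InRange N n → InRange (suc N) n
    inRange-suc {N} {n} P = inRange (ℕ.m≤n⇒m≤1+n (inRange⇒≤ {N} {n} P)) (inRange⇒counted {N} {n} P)

    inRange-split : ∀ {N n} → InRange (suc N) n → InRange N n ⊎ n ≡ suc N
    inRange-split {N} {n} P = map₁
      (λ n<1+N → inRange {N} {n} (ℕ.≤-pred n<1+N) (inRange⇒counted {suc N} {n} P))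
      (ℕ.m≤n⇒m<n∨m≡n (inRange⇒≤ {suc N} {n} P))

  count-suc-in : ∀ {N k} → Counted (suc N) → Count N k → Count (suc N) (suc k)
  count-suc-in {N} {k} counted (ns , unique , spec , #ns) =
    suc N ∷ ns , All.tabulate fresh ∷ unique , (λ n → mk⇔ (to n) (from n)) , cong suc #ns
    where
    fresh : ∀ {n} → n ∈ ns → suc N ≢ n
    fresh {n} n∈ 1+N≡n = ℕ.<⇒≱ (ℕ.≤-reflexive 1+N≡n) (inRange⇒≤ {N} {n} (Equivalence.to (spec n) n∈))
    to : ∀ n → n ∈ suc N ∷ ns → InRange (suc N) n
    to n (here n≡1+N) = inRange {suc N} {n} (ℕ.≤-reflexive n≡1+N) (subst Counted (sym n≡1+N) counted)
    to n (there n∈)   = inRange-suc {N} {n} (Equivalence.to (spec n) n∈)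
    from : ∀ n → InRange (suc N) n → n ∈ suc N ∷ ns
    from n P = [ (λ Q → there (Equivalence.from (spec n) Q)) , here ]′ (inRange-split {N} {n} P)

  count-suc-out : ∀ {N k} → ¬ Counted (suc N) → Count N k → Count (suc N) k
  count-suc-out {N} {k} ¬counted (ns , unique , spec , #ns) =
    ns , unique , (λ n → mk⇔ (to n) (from n)) , #ns
    where
    to : ∀ n → n ∈ ns → InRange (suc N) n
    to n n∈ = inRange-suc {N} {n} (Equivalence.to (spec n) n∈)
    from : ∀ n → InRange (suc N) n → n ∈ ns
    from n P = [ Equivalence.from (spec n)
               , (λ n≡1+N → contradiction (subst Counted n≡1+N (inRange⇒counted {suc N} {n} P)) ¬counted)
               ]′ (inRange-split {N} {n} P)

  -- Membership of `suc N` is undecidable, but under a refutation of all counts the inclusion of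
  -- `suc N` is refuted too, which yields the count without it.
  ¬¬count : ∀ N → ¬ ¬ ∃ (Count N)
  ¬¬count zero    ¬count = ¬count (0 , count-zero)
  ¬¬count (suc N) ¬count = ¬¬count N λ (k , count) →
    ¬count (k , count-suc-out {N} (λ counted → ¬count (suc k , count-suc-in {N} counted count)) count)

  count-run-in : ∀ {N k} i → (∀ n → N ≤ n → n ≤ i ℕ.+ N → Counted n) →
                 Count N k → Count (i ℕ.+ N) (i ℕ.+ k)
  count-run-in         zero    _   count = count
  count-run-in {N} {k} (suc i) run count = count-suc-in {i ℕ.+ N}
    (run (suc i ℕ.+ N) (ℕ.m≤n+m N (suc i)) ℕ.≤-refl)
    (count-run-in {N} i (λ n N≤n n≤ → run n N≤n (ℕ.m≤n⇒m≤1+n n≤)) count)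

  count-run-out : ∀ {N k} i → (∀ n → N ≤ n → n ≤ i ℕ.+ N → ¬ Counted n) →
                  Count N k → Count (i ℕ.+ N) k
  count-run-out         zero    _   count = count
  count-run-out {N} {k} (suc i) run count = count-suc-out {i ℕ.+ N}
    (run (suc i ℕ.+ N) (ℕ.m≤n+m N (suc i)) ℕ.≤-refl)
    (count-run-out {N} i (λ n N≤n n≤ → run n N≤n (ℕ.m≤n⇒m≤1+n n≤)) count)

-- Incompatibility of full and empty windows with a limit.

module _ {l : ℝ} {ε : ℚ} where

  open import Data.Rational.Base using (_+_; _*_; _-_)
  open import Data.Rational.Solver using (module +-*-Solver)
  open +-*-Solver using (solve; _:+_; _:*_; _:=_)
  open ℝ l

  quotient-upper : ∀ k {M} (0<M : 0ᵣ <ᵣ fromℚ M) → quotient k (fromℚ M) 0<M <ᵣ l +ᵣ ε →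
                   ∃[ q ] fromℕ k ℚ.< q * M × Lower (q - ε)
  quotient-upper k _ (q , (r , 0<r , r<M , k<qr) , lower) =
    q , ℚ.<-trans k<qr (*-mono-<ˡ 0<q r<M) , lower
    where
    0<q : 0ℚ ℚ.< q
    0<q = *-cancel-<ʳ 0<r (subst (ℚ._< q * r) (sym (ℚ.*-zeroˡ r)) (ℚ.≤-<-trans (0≤fromℕ k) k<qr))

  quotient-lower : ∀ k {N} (0<N : 0ᵣ <ᵣ fromℚ N) → 0ℚ ℚ.< N → l <ᵣ quotient k (fromℚ N) 0<N +ᵣ ε →
                   ∃[ q ] q * N ℚ.≤ fromℕ k × Upper (q + ε)
  quotient-lower k {N} _ 0<N (q , upper , r , N<r , qr<k) =
    q - ε , bound , subst Upper (sym (x-y+y q ε)) upper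
    where
    bound : (q - ε) * N ℚ.≤ fromℕ k
    bound with ℚ.≤-total 0ℚ (q - ε)
    ... | inj₁ 0≤q = ℚ.≤-trans (*-mono-≤ˡ 0≤q (ℚ.<⇒≤ N<r)) (ℚ.<⇒≤ qr<k)
    -- For `q - ε ≤ 0` the cut says nothing useful at `N < r`, but the bound is trivial since counts
    -- are nonnegative.
    ... | inj₂ q≤0 = ℚ.≤-trans
      (ℚ.≤-trans (ℚ.*-monoʳ-≤-nonNeg N {{ℚ.nonNegative (ℚ.<⇒≤ 0<N)}} q≤0) (ℚ.≤-reflexive (ℚ.*-zeroˡ N)))
      (0≤fromℕ k)

  -- `k / M < l + ε` and `l < j / N + ε` combine to `k / M < j / N + 2 ε`: the limit is eliminated,
  -- and with denominators cleared only rationals remain.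
  quotient-compare : ∀ k j {M N} (0<M : 0ᵣ <ᵣ fromℚ M) (0<N : 0ᵣ <ᵣ fromℚ N) → 0ℚ ℚ.< M → 0ℚ ℚ.< N →
                     quotient k (fromℚ M) 0<M <ᵣ l +ᵣ ε → l <ᵣ quotient j (fromℚ N) 0<N +ᵣ ε →
                     fromℕ k * N ℚ.< fromℕ j * M + (ε + ε) * (M * N)
  quotient-compare k j {M} {N} 0<ᵣM 0<ᵣN 0<M 0<N near-k near-j =
    combine (quotient-upper k 0<ᵣM near-k) (quotient-lower j 0<ᵣN 0<N near-j)
    where
    open ℚ.≤-Reasoning
    combine : (∃[ q ] fromℕ k ℚ.< q * M × Lower (q - ε)) → (∃[ g ] g * N ℚ.≤ fromℕ j × Upper (g + ε)) →
              fromℕ k * N ℚ.< fromℕ j * M + (ε + ε) * (M * N)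
    combine (q , k<qM , lower) (g , gN≤j , upper) = begin-strict
      fromℕ k * N                       <⟨ *-mono-<ʳ 0<N k<qM ⟩
      q * M * N                         <⟨ *-mono-<ʳ 0<N (*-mono-<ʳ 0<M q<) ⟩
      (g + ε + ε) * M * N               ≡⟨ solve 4 (λ g e M N → (g :+ e :+ e) :* M :* N
                                             := g :* N :* M :+ (e :+ e) :* (M :* N)) refl g ε M N ⟩
      g * N * M + (ε + ε) * (M * N)     ≤⟨ ℚ.+-monoˡ-≤ ((ε + ε) * (M * N))
                                             (ℚ.*-monoʳ-≤-nonNeg M {{ℚ.nonNegative (ℚ.<⇒≤ 0<M)}} gN≤j) ⟩
      fromℕ j * M + (ε + ε) * (M * N)   ∎
      where
      q< : q ℚ.< g + ε + ε
      q< = subst (ℚ._< g + ε + ε) (x-y+y q ε) (ℚ.+-monoˡ-< ε (ℝ.lower<upper l lower upper))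

module Density (b : Sequence) (α : ℝ) (l : ℝ) (lim : DensityTendsTo b α l) where

  open Counting b α

  -- The Cauchy property of Count N / N, with tolerance 1 / E and denominators cleared.
  count-cauchy : ∀ E .{{_ : ℕ.NonZero E}} → ∃[ X ] ∀ {M N k j} → X < M → X < N → Count M k → Count N j →
                 E ℕ.* (k ℕ.* N) < E ℕ.* (j ℕ.* M) ℕ.+ M ℕ.* N
  count-cauchy E = X , λ {M} {N} {k} {j} X<M X<N count count′ → fromℕ-cancel-< (begin-strict
      fromℕ (E ℕ.* (k ℕ.* N))                   ≡⟨ trans (fromℕ-* E (k ℕ.* N)) (cong (fromℕ E *_) (fromℕ-* k N)) ⟩
      fromℕ E * (fromℕ k * fromℕ N)             <⟨ *-mono-<ˡ 0<E (quotient-compare {l} {ε} k j (pos X<M) (pos X<N)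
                                                     (0<fromℕ X<M) (0<fromℕ X<N)
                                                     (proj₁ (near {M} {k} X<M count)) (proj₂ (near {N} {j} X<N count′))) ⟩
      fromℕ E * (fromℕ j * fromℕ M + (ε + ε) * (fromℕ M * fromℕ N))
        ≡⟨ cong (λ e → fromℕ E * (fromℕ j * fromℕ M + e * (fromℕ M * fromℕ N))) ε+ε ⟩
      fromℕ E * (fromℕ j * fromℕ M + inv (fromℕ E) 0<E * (fromℕ M * fromℕ N))
        ≡⟨ distrib (fromℕ E) (fromℕ j * fromℕ M) (inv (fromℕ E) 0<E) (fromℕ M * fromℕ N) (inv-*ʳ 0<E) ⟩
      fromℕ E * (fromℕ j * fromℕ M) + fromℕ M * fromℕ N
        ≡⟨ cong₂ _+_ (trans (fromℕ-* E (j ℕ.* M)) (cong (fromℕ E *_) (fromℕ-* j M))) (fromℕ-* M N) ⟨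
      fromℕ (E ℕ.* (j ℕ.* M)) + fromℕ (M ℕ.* N) ≡⟨ fromℕ-+ (E ℕ.* (j ℕ.* M)) (M ℕ.* N) ⟨
      fromℕ (E ℕ.* (j ℕ.* M) ℕ.+ M ℕ.* N)       ∎)
    where
    open import Data.Rational.Base using (_+_; _*_; ½)
    open ℚ.≤-Reasoning
    0<E : 0ℚ ℚ.< fromℕ E
    0<E = ℚ.<-≤-trans 0<1 (1≤fromℕ E)
    ε = inv (fromℕ E) 0<E * ½
    0<ε : 0ℚ ℚ.< ε
    0<ε = *-pos (inv-pos 0<E) (ℚ.positive⁻¹ ½)
    ε+ε : ε + ε ≡ inv (fromℕ E) 0<E
    ε+ε = trans (sym (ℚ.*-distribˡ-+ (inv (fromℕ E) 0<E) ½ ½)) (ℚ.*-identityʳ (inv (fromℕ E) 0<E))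
    bound = ℝ.upper-inhabited (proj₁ (lim ε 0<ε))
    X = proj₁ (x<fromℕ (proj₁ bound))
    0<fromℕ : ∀ {M} → X < M → 0ℚ ℚ.< fromℕ M
    0<fromℕ {M} X<M = fromℕ-mono-< {0} {M} (ℕ.≤-<-trans ℕ.z≤n X<M)
    pos : ∀ {M} → X < M → 0ᵣ <ᵣ fromℚ (fromℕ M)
    pos X<M = ℚ.<-dense (0<fromℕ X<M)
    near : ∀ {M k} (X<M : X < M) → Count M k → ∣ quotient k (fromℚ (fromℕ M)) (pos X<M) - l ∣< ε
    near {M} {k} X<M = proj₂ (lim ε 0<ε) (fromℚ (fromℕ M)) (pos X<M)
      (proj₁ bound , proj₂ bound , ℚ.<-trans (proj₂ (x<fromℕ (proj₁ bound))) (fromℕ-mono-< X<M)) k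
    distrib : ∀ e x i y → e * i ≡ 1ℚ → e * (x + i * y) ≡ e * x + y
    distrib e x i y ei≡1 = trans (ℚ.*-distribˡ-+ e x (i * y)) (cong (_+_ (e * x))
      (trans (sym (ℚ.*-assoc e i y)) (trans (cong (_* y) ei≡1) (ℚ.*-identityˡ y))))

  private
    -- k, l are the counts at u S, v S; the three inequalities scaled by v, u, 1 add up to a contradiction.
    windows-incompatible : ∀ u v S k l .{{_ : ℕ.NonZero S}} → let E = u ℕ.+ v ℕ.+ 3 in 1 ≤ v →
      E ℕ.* ((S ℕ.+ k) ℕ.* (u ℕ.* S)) < E ℕ.* (k ℕ.* (S ℕ.+ u ℕ.* S)) ℕ.+ (S ℕ.+ u ℕ.* S) ℕ.* (u ℕ.* S) →
      E ℕ.* (l ℕ.* (S ℕ.+ v ℕ.* S)) < E ℕ.* (l ℕ.* (v ℕ.* S)) ℕ.+ (v ℕ.* S) ℕ.* (S ℕ.+ v ℕ.* S) →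
      E ℕ.* (k ℕ.* (v ℕ.* S)) < E ℕ.* (l ℕ.* (u ℕ.* S)) ℕ.+ (u ℕ.* S) ℕ.* (v ℕ.* S) → ⊥
    windows-incompatible u v S k l 1≤v h₁ h₂ h₃ = ℕ.<-irrefl (close u v S) (begin-strict
      E * (S * u) * v                                        <⟨ ℕ.*-monoˡ-< v {{ℕ.>-nonZero 1≤v}} h₁′ ⟩
      (E * k + suc u * u * S) * v                            ≡⟨ expand E k (suc u * u * S) v ⟩
      E * (k * v) + suc u * u * S * v                        ≤⟨ ℕ.+-monoˡ-≤ _ (ℕ.<⇒≤ h₃′) ⟩
      E * (l * u) + u * v * S + suc u * u * S * v            ≡⟨ cong (λ m → m + u * v * S + suc u * u * S * v) (swap E l u) ⟩
      u * (E * l) + u * v * S + suc u * u * S * v            ≤⟨ ℕ.+-monoˡ-≤ _ (ℕ.+-monoˡ-≤ _ (ℕ.*-monoʳ-≤ u (ℕ.<⇒≤ h₂′))) ⟩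
      u * (v * suc v * S) + u * v * S + suc u * u * S * v    ∎)
      where
      open import Data.Nat.Base using (_+_; _*_)
      open ℕ.≤-Reasoning
      -- Chosen so that the errors `u + 1`, `v + 1` and 1 of the three inequalities, in units of
      -- `1 / E`, add up to exactly 1. Strictness then gives the contradiction.
      E = u + v + 3
      close : ∀ u v S → (u + v + 3) * (S * u) * v ≡ u * (v * suc v * S) + u * v * S + suc u * u * S * v
      close = solve-∀
      expand : ∀ E k m v → (E * k + m) * v ≡ E * (k * v) + m * v
      expand = solve-∀
      swap : ∀ E l u → E * (l * u) ≡ u * (E * l)
      swap = solve-∀
      cancel : ∀ {m n m′ n′} → m ≡ m′ * S → n ≡ n′ * S → m < n → m′ < n′
      cancel {m′ = m′} {n′} refl refl = ℕ.*-cancelʳ-< S m′ n′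
      cancel+ : ∀ {m n m′ n′} c → m ≡ c + m′ * S → n ≡ c + n′ * S → m < n → m′ < n′
      cancel+ {m′ = m′} {n′} c refl refl h = ℕ.*-cancelʳ-< S m′ n′ (ℕ.+-cancelˡ-< c _ _ h)
      lhs₁ : ∀ E k u S → E * ((S + k) * (u * S)) ≡ E * (k * (u * S)) + E * (S * u) * S
      lhs₁ = solve-∀
      rhs₁ : ∀ E k u S → E * (k * (S + u * S)) + (S + u * S) * (u * S) ≡
                         E * (k * (u * S)) + (E * k + suc u * u * S) * S
      rhs₁ = solve-∀
      -- Divided by `E u S`: the density at `u S` exceeds `1 - (u + 1) / E`.
      h₁′ : E * (S * u) < E * k + suc u * u * S
      h₁′ = cancel+ (E * (k * (u * S))) (lhs₁ E k u S) (rhs₁ E k u S) h₁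
      lhs₂ : ∀ E l v S → E * (l * (S + v * S)) ≡ E * (l * (v * S)) + E * l * S
      lhs₂ = solve-∀
      rhs₂ : ∀ E l v S → E * (l * (v * S)) + v * S * (S + v * S) ≡ E * (l * (v * S)) + v * suc v * S * S
      rhs₂ = solve-∀
      -- The density at `v S` is below `(v + 1) / E`.
      h₂′ : E * l < v * suc v * S
      h₂′ = cancel+ (E * (l * (v * S))) (lhs₂ E l v S) (rhs₂ E l v S) h₂
      lhs₃ : ∀ E k v S → E * (k * (v * S)) ≡ E * (k * v) * S
      lhs₃ = solve-∀
      rhs₃ : ∀ E l u v S → E * (l * (u * S)) + u * S * (v * S) ≡ (E * (l * u) + u * v * S) * S
      rhs₃ = solve-∀
      h₃′ : E * (k * v) < E * (l * u) + u * v * S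
      h₃′ = cancel (lhs₃ E k v S) (rhs₃ E l u v S) h₃

  -- Passing the full window adds S to the count over S integers and forces the density towards 1;
  -- passing the empty one forces it towards 0. A common scale lets the counts at `u S` and `v S` be
  -- compared directly.
  windows-contradict : ∀ s → 2 ≤ s → ∀ u v → 1 ≤ u → 1 ≤ v →
    (∀ i n .{{_ : ℕ.NonZero n}} → u ℕ.* s ℕ.^ i ≤ n → n ≤ suc u ℕ.* s ℕ.^ i → b n ≤ᵣ α) →
    (∀ i n .{{_ : ℕ.NonZero n}} → v ℕ.* s ℕ.^ i ≤ n → n ≤ suc v ℕ.* s ℕ.^ i → ¬ (b n ≤ᵣ α)) → ⊥
  windows-contradict s 2≤s u v 1≤u 1≤v all none =
    ¬¬count (u ℕ.* S) λ (k , countᵤ) → ¬¬count (v ℕ.* S) λ (l , countᵥ) →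
      windows-incompatible u v S k l {{ℕ.>-nonZero (ℕ.≤-<-trans ℕ.z≤n X<S)}} 1≤v
        (cauchy {S ℕ.+ u ℕ.* S} {u ℕ.* S} {S ℕ.+ k} {k} (X<S+ u) (X<* 1≤u)
          (count-run-in {u ℕ.* S} {k} S allX countᵤ) countᵤ)
        (cauchy {v ℕ.* S} {S ℕ.+ v ℕ.* S} {l} {l} (X<* 1≤v) (X<S+ v)
          countᵥ (count-run-out {v ℕ.* S} {l} S noneX countᵥ))
        (cauchy {u ℕ.* S} {v ℕ.* S} {k} {l} (X<* 1≤u) (X<* 1≤v) countᵤ countᵥ)
    where
    E≢0 : ℕ.NonZero (u ℕ.+ v ℕ.+ 3)
    E≢0 = ℕ.>-nonZero (ℕ.<-≤-trans ℕ.z<s (ℕ.m≤n+m 3 (u ℕ.+ v)))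
    X = proj₁ (count-cauchy (u ℕ.+ v ℕ.+ 3) {{E≢0}})
    cauchy = proj₂ (count-cauchy (u ℕ.+ v ℕ.+ 3) {{E≢0}})
    -- The threshold `X` doubles as the exponent: `X < s ^ X` already puts all four points beyond
    -- it.
    S = s ℕ.^ X
    n<s^n : ∀ n → n < s ℕ.^ n
    n<s^n zero    = ℕ.z<s
    n<s^n (suc n) = ℕ.≤-trans (ℕ.≤-trans (ℕ.+-mono-≤ (ℕ.≤-trans (ℕ.s≤s ℕ.z≤n) (n<s^n n)) (n<s^n n))
      (ℕ.≤-reflexive (cong (ℕ._+_ (s ℕ.^ n)) (sym (ℕ.+-identityʳ (s ℕ.^ n))))))
      (ℕ.*-monoˡ-≤ (s ℕ.^ n) 2≤s)
    X<S : X < S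
    X<S = n<s^n X
    X<* : ∀ {w} → 1 ≤ w → X < w ℕ.* S
    X<* {w} 1≤w = ℕ.<-≤-trans X<S (ℕ.m≤n*m S w {{ℕ.>-nonZero 1≤w}})
    X<S+ : ∀ w → X < S ℕ.+ w ℕ.* S
    X<S+ w = ℕ.<-≤-trans X<S (ℕ.m≤m+n S (w ℕ.* S))
    allX : ∀ n → u ℕ.* S ≤ n → n ≤ suc u ℕ.* S → Counted n
    allX n lo hi = n≢0 , all X n {{n≢0}} lo hi
      where n≢0 = ℕ.>-nonZero (ℕ.≤-<-trans ℕ.z≤n (ℕ.<-≤-trans (X<* 1≤u) lo))
    noneX : ∀ n → v ℕ.* S ≤ n → n ≤ suc v ℕ.* S → ¬ Counted n
    noneX n lo hi (n≢0 , b≤α) = none X n {{n≢0}} lo hi b≤α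

-- Windows on which `b` stays on one side of `α`.

module Windows (p s : ℕ) (2≤s : 2 ≤ s) (s<p : s < p) (h : Fin s → Fin p)
               (increasing : ∀ {i j} → i Fin.< j → h i Fin.< h j) where

  open import Data.Rational.Base using (_*_; _-_; _+_)
  open ℚ^ using (_^_)
  open DigitSequence p s 2≤s s<p h using (a; b; logₛp)
  open Digits p s 2≤s s<p h increasing using (a₀; a≡a₀; n≤a₀; a₀-lower; a₀-upper)

  private
    1<s = 1<fromℕ s 2≤s
    s≤p = fromℕ-mono-≤ (ℕ.<⇒≤ s<p)
    1≤p = 1≤fromℕ p {{ℕ.>-nonZero (ℕ.≤-<-trans ℕ.z≤n s<p)}}

  open Exponent (fromℕ s) (fromℕ p) 1<s s≤p

  npow : ∀ n .{{_ : ℕ.NonZero n}} → ℝ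
  npow n = rpow (fromℕ n) (1≤fromℕ n) logₛp

  private
    npow-upper-pos : ∀ n .{{_ : ℕ.NonZero n}} {r} → ℝ.Upper (npow n) r → 0ℚ ℚ.< r
    npow-upper-pos n upper = ℝ.lower<upper (npow n) (lower-0 (npow n) (rpow-pos (fromℕ n) (1≤fromℕ n) logₛp)) upper

    *-swapʳ : ∀ x y z → x * y * z ≡ x * z * y
    *-swapʳ x y z = trans (ℚ.*-assoc x y z) (trans (cong (x *_) (ℚ.*-comm y z)) (sym (ℚ.*-assoc x z y)))

    scale-lower : ∀ J i {z u N} → fromℕ (s ℕ.^ J) * z ℚ.≤ fromℕ u → u ℕ.* s ℕ.^ i ≤ N →
                  fromℕ s ^ (J ℕ.+ i) * z ℚ.≤ fromℕ N
    scale-lower J i {z} {u} {N} sᴶz≤u usⁱ≤N = begin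
      fromℕ s ^ (J ℕ.+ i) * z            ≡⟨ cong (_* z) (fromℕ-^ s (J ℕ.+ i)) ⟨
      fromℕ (s ℕ.^ (J ℕ.+ i)) * z        ≡⟨ cong (λ m → fromℕ m * z) (ℕ.^-distribˡ-+-* s J i) ⟩
      fromℕ (s ℕ.^ J ℕ.* s ℕ.^ i) * z    ≡⟨ cong (_* z) (fromℕ-* (s ℕ.^ J) (s ℕ.^ i)) ⟩
      fromℕ (s ℕ.^ J) * fromℕ (s ℕ.^ i) * z
        ≡⟨ *-swapʳ (fromℕ (s ℕ.^ J)) (fromℕ (s ℕ.^ i)) z ⟩
      fromℕ (s ℕ.^ J) * z * fromℕ (s ℕ.^ i)
        ≤⟨ ℚ.*-monoʳ-≤-nonNeg (fromℕ (s ℕ.^ i)) {{ℚ.nonNegative (0≤fromℕ (s ℕ.^ i))}} sᴶz≤u ⟩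
      fromℕ u * fromℕ (s ℕ.^ i)          ≡⟨ fromℕ-* u (s ℕ.^ i) ⟨
      fromℕ (u ℕ.* s ℕ.^ i)              ≤⟨ fromℕ-mono-≤ usⁱ≤N ⟩
      fromℕ N                            ∎
      where
      open ℚ.≤-Reasoning

    scale-upper : ∀ J i {z v N} → fromℕ v ℚ.≤ fromℕ (s ℕ.^ J) * z → N ≤ v ℕ.* s ℕ.^ i →
                  fromℕ N ℚ.≤ fromℕ s ^ (J ℕ.+ i) * z
    scale-upper J i {z} {v} {N} v≤sᴶz N≤vsⁱ = begin
      fromℕ N                            ≤⟨ fromℕ-mono-≤ N≤vsⁱ ⟩
      fromℕ (v ℕ.* s ℕ.^ i)              ≡⟨ fromℕ-* v (s ℕ.^ i) ⟩
      fromℕ v * fromℕ (s ℕ.^ i)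
        ≤⟨ ℚ.*-monoʳ-≤-nonNeg (fromℕ (s ℕ.^ i)) {{ℚ.nonNegative (0≤fromℕ (s ℕ.^ i))}} v≤sᴶz ⟩
      fromℕ (s ℕ.^ J) * z * fromℕ (s ℕ.^ i)
        ≡⟨ *-swapʳ (fromℕ (s ℕ.^ J)) z (fromℕ (s ℕ.^ i)) ⟩
      fromℕ (s ℕ.^ J) * fromℕ (s ℕ.^ i) * z ≡⟨ cong (_* z) (fromℕ-* (s ℕ.^ J) (s ℕ.^ i)) ⟨
      fromℕ (s ℕ.^ J ℕ.* s ℕ.^ i) * z    ≡⟨ cong (λ m → fromℕ m * z) (ℕ.^-distribˡ-+-* s J i) ⟨
      fromℕ (s ℕ.^ (J ℕ.+ i)) * z        ≡⟨ cong (_* z) (fromℕ-^ s (J ℕ.+ i)) ⟩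
      fromℕ s ^ (J ℕ.+ i) * z            ∎
      where
      open ℚ.≤-Reasoning

    -- Appending J further digits stretches a gap `d` until it has room for an integer window.
    sᴶ-large : ∀ c {d} → 0ℚ ℚ.< d → ∃[ J ] c ℚ.≤ fromℕ (s ℕ.^ J) * d
    sᴶ-large c {d} 0<d = suc (proj₁ large) , (begin
      c                                   ≡⟨ *-inv-cancel c 0<d ⟨
      c * inv d 0<d * d                   ≤⟨ ℚ.*-monoʳ-≤-nonNeg d {{ℚ.nonNegative (ℚ.<⇒≤ 0<d)}} (proj₂ large) ⟩
      fromℕ s ^ suc (proj₁ large) * d     ≡⟨ cong (_* d) (fromℕ-^ s (suc (proj₁ large))) ⟨
      fromℕ (s ℕ.^ suc (proj₁ large)) * d ∎)
      where
      open ℚ.≤-Reasoning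
      large = ^-unbounded 1<s (c * inv d 0<d)

    -- With K = J + i, `a_N < p^K (a_n + 1) = p^K q c` and `N^θ ≥ p^K z^θ ≥ p^K c`, so `b_N` cannot
    -- exceed `q < α`.
    window-below′ : ∀ {α : ℝ} n {q c z} → ℝ.Lower α q → 0ℚ ℚ.< q → 0ℚ ℚ.< c →
      q * c ≡ fromℕ (suc (a₀ n)) → 1ℚ ℚ.≤ z → Below z c →
      .{{_ : ℕ.NonZero n}} →
      ∀ J i N .{{_ : ℕ.NonZero N}} → fromℕ s ^ (J ℕ.+ i) * z ℚ.≤ fromℕ N → N < suc n ℕ.* s ℕ.^ (J ℕ.+ i) →
      b N ≤ᵣ α
    window-below′ {α} n {q} {c} {z} lower 0<q 0<c qc≡ 1≤z below J i N sᴷz≤N N< (q′ , upper , r , upper-r , q′r<a) =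
      ℚ.<-irrefl refl (begin-strict
        fromℕ (a N)                         ≡⟨ cong fromℕ (a≡a₀ N) ⟩
        fromℕ (a₀ N)                        <⟨ fromℕ-mono-< (a₀-upper K n N<) ⟩
        fromℕ (suc (a₀ n) ℕ.* p ℕ.^ K)      ≡⟨ fromℕ-* (suc (a₀ n)) (p ℕ.^ K) ⟩
        fromℕ (suc (a₀ n)) * fromℕ (p ℕ.^ K) ≡⟨ cong₂ _*_ (sym qc≡) (fromℕ-^ p K) ⟩
        q * c * fromℕ p ^ K                 ≡⟨ ℚ.*-assoc q c _ ⟩
        q * (c * fromℕ p ^ K)               ≡⟨ cong (q *_) (ℚ.*-comm c _) ⟩
        q * (fromℕ p ^ K * c)               ≤⟨ *-mono-≤ˡ (ℚ.<⇒≤ 0<q) pᴷc≤r ⟩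
        q * r                               <⟨ *-mono-<ʳ 0<r (ℝ.lower<upper α lower upper) ⟩
        q′ * r                              <⟨ q′r<a ⟩
        fromℕ (a N)                         ∎)
      where
      open ℚ.≤-Reasoning
      K = J ℕ.+ i
      0<r = npow-upper-pos N upper-r
      pᴷc≤r : fromℕ p ^ K * c ℚ.≤ r
      pᴷc≤r = below⇒≤above K 1≤z 0<c 0<r below
        (upper⇒above 1<s s≤p 1≤p (1≤fromℕ N) upper-r) sᴷz≤N

    window-above′ : ∀ {α : ℝ} n {q c z} → ℝ.Upper α q → 0ℚ ℚ.< q → 0ℚ ℚ.< c →
      q * c ≡ fromℕ (a₀ n) → 1ℚ ℚ.≤ z → Above z c →
      .{{_ : ℕ.NonZero n}} →
      ∀ J i N .{{_ : ℕ.NonZero N}} → fromℕ N ℚ.≤ fromℕ s ^ (J ℕ.+ i) * z → n ℕ.* s ℕ.^ (J ℕ.+ i) ≤ N →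
      α <ᵣ b N
    -- The estimate only refutes `b_N < q`. A rational `q′ < q` still above `α`, together with
    -- locatedness of `b_N`, turns this into a strict inequality.
    window-above′ {α} n {q} {c} {z} upper 0<q 0<c qc≡ 1≤z above J i N N≤sᴷz ≤N = choose (ℝ.upper-open α upper)
      where
      K = J ℕ.+ i
      ¬upper : ¬ ℝ.Upper (b N) q
      ¬upper (t , 0<t , lower-t , a<qt) = ℚ.<-irrefl refl (begin-strict
        fromℕ (a N)                     <⟨ a<qt ⟩
        q * t                           ≤⟨ *-mono-≤ˡ (ℚ.<⇒≤ 0<q) (below≤⇒above K 1≤z 0<t 0<c above
                                             (lower⇒below 1<s s≤p 1≤p (1≤fromℕ N) 0<t lower-t)
                                             (ℚ.<-≤-trans 0<1 (1≤fromℕ N)) N≤sᴷz) ⟩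
        q * (fromℕ p ^ K * c)           ≡⟨ cong (q *_) (ℚ.*-comm _ c) ⟩
        q * (c * fromℕ p ^ K)           ≡⟨ ℚ.*-assoc q c _ ⟨
        q * c * fromℕ p ^ K             ≡⟨ cong₂ _*_ qc≡ (sym (fromℕ-^ p K)) ⟩
        fromℕ (a₀ n) * fromℕ (p ℕ.^ K)  ≡⟨ fromℕ-* (a₀ n) (p ℕ.^ K) ⟨
        fromℕ (a₀ n ℕ.* p ℕ.^ K)        ≤⟨ fromℕ-mono-≤ (a₀-lower K n ≤N) ⟩
        fromℕ (a₀ N)                    ≡⟨ cong fromℕ (a≡a₀ N) ⟨
        fromℕ (a N)                     ∎)
        where open ℚ.≤-Reasoning
      choose : ∃[ q′ ] q′ ℚ.< q × ℝ.Upper α q′ → α <ᵣ b N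
      choose (q′ , q′<q , upper′) = [ (λ lower → q′ , upper′ , lower)
        , (λ upper″ → contradiction upper″ ¬upper) ]′ (ℝ.located (b N) q′<q)

  window-below : ∀ {α} n .{{_ : ℕ.NonZero n}} → b n <ᵣ α →
    ∃[ u ] 1 ≤ u × ∀ i N .{{_ : ℕ.NonZero N}} → u ℕ.* s ℕ.^ i ≤ N → N ≤ suc u ℕ.* s ℕ.^ i → b N ≤ᵣ α
  window-below {α} n (q , (r , 0<r , lower-r , a<qr) , lower) =
    shrink (below-shrink 0<c c<ρr (subst (λ z → Below z (ρ * r)) (*-inv-cancel (fromℕ (suc n)) 0<n)
      (below-dilate 1≤ρ 0<r (lower⇒below 1<s s≤p 1≤p (1≤fromℕ n) 0<r lower-r))))
    where
    open ℚ.≤-Reasoning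
    0<n : 0ℚ ℚ.< fromℕ n
    0<n = ℚ.<-≤-trans 0<1 (1≤fromℕ n)
    0<1+n : 0ℚ ℚ.< fromℕ (suc n)
    0<1+n = ℚ.<-≤-trans 0<1 (1≤fromℕ (suc n))
    0<q : 0ℚ ℚ.< q
    0<q = *-cancel-<ʳ 0<r (subst (ℚ._< q * r) (sym (ℚ.*-zeroˡ r)) (ℚ.≤-<-trans (0≤fromℕ (a n)) a<qr))
    ρ = fromℕ (suc n) * inv (fromℕ n) 0<n
    1≤ρ : 1ℚ ℚ.≤ ρ
    1≤ρ = subst (ℚ._≤ ρ) (inv-*ʳ 0<n) (ℚ.*-monoʳ-≤-nonNeg (inv (fromℕ n) 0<n)
      {{ℚ.nonNegative (ℚ.<⇒≤ (inv-pos 0<n))}} (fromℕ-mono-≤ (ℕ.n≤1+n n)))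
    -- The value that `N^θ / p^K` has to reach for `(a_n + 1) p^K / N^θ ≤ q`.
    c = fromℕ (suc (a₀ n)) * inv q 0<q
    0<c = *-pos (ℚ.<-≤-trans 0<1 (1≤fromℕ (suc (a₀ n)))) (inv-pos 0<q)
    qc≡ : q * c ≡ fromℕ (suc (a₀ n))
    qc≡ = trans (ℚ.*-comm q c) (*-inv-cancel (fromℕ (suc (a₀ n))) 0<q)
    -- (a n + 1) / a n ≤ (n + 1) / n because a n ≥ n
    ratio : fromℕ (suc (a₀ n)) ℚ.≤ ρ * fromℕ (a₀ n)
    ratio = ℚ.*-cancelʳ-≤-pos (fromℕ n) {{ℚ.positive 0<n}} (begin
      fromℕ (suc (a₀ n)) * fromℕ n        ≡⟨ fromℕ-* (suc (a₀ n)) n ⟨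
      fromℕ (n ℕ.+ a₀ n ℕ.* n)            ≤⟨ fromℕ-mono-≤ (ℕ.+-monoˡ-≤ (a₀ n ℕ.* n) (n≤a₀ n)) ⟩
      fromℕ (a₀ n ℕ.+ a₀ n ℕ.* n)         ≡⟨ cong fromℕ (ℕ.*-suc (a₀ n) n) ⟨
      fromℕ (a₀ n ℕ.* suc n)              ≡⟨ fromℕ-* (a₀ n) (suc n) ⟩
      fromℕ (a₀ n) * fromℕ (suc n)        ≡⟨ cong (fromℕ (a₀ n) *_) (*-inv-cancel (fromℕ (suc n)) 0<n) ⟨
      fromℕ (a₀ n) * (ρ * fromℕ n)        ≡⟨ ℚ.*-assoc (fromℕ (a₀ n)) ρ (fromℕ n) ⟨
      fromℕ (a₀ n) * ρ * fromℕ n          ≡⟨ cong (_* fromℕ n) (ℚ.*-comm (fromℕ (a₀ n)) ρ) ⟩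
      ρ * fromℕ (a₀ n) * fromℕ n          ∎)
    c<ρr : c ℚ.< ρ * r
    c<ρr = *-cancel-<ʳ 0<q (begin-strict
      c * q                   ≡⟨ *-inv-cancel (fromℕ (suc (a₀ n))) 0<q ⟩
      fromℕ (suc (a₀ n))      ≤⟨ ratio ⟩
      ρ * fromℕ (a₀ n)        ≡⟨ cong (λ m → ρ * fromℕ m) (a≡a₀ n) ⟨
      ρ * fromℕ (a n)         <⟨ *-mono-<ˡ (ℚ.<-≤-trans 0<1 1≤ρ) a<qr ⟩
      ρ * (q * r)             ≡⟨ cong (ρ *_) (ℚ.*-comm q r) ⟩
      ρ * (r * q)             ≡⟨ ℚ.*-assoc ρ r q ⟨
      ρ * r * q               ∎)
    shrink : ∃[ σ ] 0ℚ ℚ.< σ × σ ℚ.< 1ℚ × Below (σ * fromℕ (suc n)) c →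
             ∃[ u ] 1 ≤ u × ∀ i N .{{_ : ℕ.NonZero N}} → u ℕ.* s ℕ.^ i ≤ N → N ≤ suc u ℕ.* s ℕ.^ i → b N ≤ᵣ α
    shrink (σ , 0<σ , σ<1 , below) = u , 1≤u , λ i N lo hi →
      window-below′ {α} n lower 0<q 0<c qc≡ 1≤z below′ J i N
        (scale-lower J i {z} {u} {N} sᴶz≤u lo) (top i N hi)
      where
      -- The maximum with 1 secures `1 ≤ z` for the exponent comparison; it stays below `n + 1`
      -- because `n ≥ 1`.
      z = σ * fromℕ (suc n) ℚ.⊔ 1ℚ
      1≤z : 1ℚ ℚ.≤ z
      1≤z = ℚ.p≤q⊔p (σ * fromℕ (suc n)) 1ℚ
      z<1+n : z ℚ.< fromℕ (suc n)
      z<1+n = ⊔-least-<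
        (subst (σ * fromℕ (suc n) ℚ.<_) (ℚ.*-identityˡ (fromℕ (suc n))) (*-mono-<ʳ 0<1+n σ<1))
        (1<fromℕ (suc n) (ℕ.s≤s (ℕ.>-nonZero⁻¹ n)))
      below′ = below-mono {σ * fromℕ (suc n)} {z} {c} (*-pos 0<σ 0<1+n) (ℚ.p≤p⊔q (σ * fromℕ (suc n)) 1ℚ) below
      d = fromℕ (suc n) - z
      large = sᴶ-large (fromℕ 2) {d} (x<y⇒0<y-x z<1+n)
      J = proj₁ large
      T = s ℕ.^ J
      -- Subtracting 2, not 1: the right end `suc u * s ^ i` belongs to the window, yet must lie
      -- strictly below the end of the block of `n`. Hence the gap of 2 asked of `J`.
      u = suc n ℕ.* T ℕ.∸ 2
      room : fromℕ 2 + fromℕ T * z ℚ.≤ fromℕ (suc n ℕ.* T)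
      room = begin
        fromℕ 2 + fromℕ T * z          ≤⟨ ℚ.+-monoˡ-≤ (fromℕ T * z) (proj₂ large) ⟩
        fromℕ T * d + fromℕ T * z      ≡⟨ ℚ.*-distribˡ-+ (fromℕ T) d z ⟨
        fromℕ T * (d + z)              ≡⟨ cong (fromℕ T *_) (x-y+y (fromℕ (suc n)) z) ⟩
        fromℕ T * fromℕ (suc n)        ≡⟨ ℚ.*-comm (fromℕ T) (fromℕ (suc n)) ⟩
        fromℕ (suc n) * fromℕ T        ≡⟨ fromℕ-* (suc n) T ⟨
        fromℕ (suc n ℕ.* T)            ∎
      1≤Tz : 1ℚ ℚ.≤ fromℕ T * z
      1≤Tz = *-mono-≤ {1ℚ} {z} {fromℕ T} {1ℚ} (ℚ.<⇒≤ 0<1) (ℚ.<⇒≤ (ℚ.<-≤-trans 0<1 1≤z))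
        (1≤fromℕ T {{ℕ.m^n≢0 s J {{ℕ.>-nonZero (ℕ.<-≤-trans ℕ.z<s 2≤s)}}}}) 1≤z
      3≤ : 3 ≤ suc n ℕ.* T
      3≤ = fromℕ-cancel-≤ (begin
        fromℕ 3                  ≡⟨ fromℕ-+ 2 1 ⟩
        fromℕ 2 + 1ℚ             ≤⟨ ℚ.+-monoʳ-≤ (fromℕ 2) 1≤Tz ⟩
        fromℕ 2 + fromℕ T * z    ≤⟨ room ⟩
        fromℕ (suc n ℕ.* T)      ∎)
      1≤u : 1 ≤ u
      1≤u = ℕ.∸-monoˡ-≤ 2 3≤
      2+u : 2 ℕ.+ u ≡ suc n ℕ.* T
      2+u = ℕ.m+[n∸m]≡n {2} (ℕ.≤-trans (ℕ.s≤s (ℕ.s≤s ℕ.z≤n)) 3≤)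
      sᴶz≤u : fromℕ T * z ℚ.≤ fromℕ u
      sᴶz≤u = cancel (fromℕ 2) (ℚ.≤-trans room (ℚ.≤-reflexive (trans (cong fromℕ (sym 2+u)) (fromℕ-+ 2 u))))
        where
        cancel : ∀ x {y w} → x + y ℚ.≤ x + w → y ℚ.≤ w
        cancel x {y} {w} le = ℚ.≮⇒≥ λ w<y → ℚ.<-irrefl refl (ℚ.<-≤-trans (ℚ.+-monoʳ-< x w<y) le)
      top : ∀ i N → N ≤ suc u ℕ.* s ℕ.^ i → N < suc n ℕ.* s ℕ.^ (J ℕ.+ i)
      top i N hi = ℕ.≤-<-trans hi (subst (suc u ℕ.* s ℕ.^ i <_)
        (trans (cong (ℕ._* s ℕ.^ i) 2+u) (trans (ℕ.*-assoc (suc n) T (s ℕ.^ i))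
          (cong (suc n ℕ.*_) (sym (ℕ.^-distribˡ-+-* s J i)))))
        (ℕ.*-monoˡ-< (s ℕ.^ i) {{ℕ.m^n≢0 s i {{ℕ.>-nonZero (ℕ.<-≤-trans ℕ.z<s 2≤s)}}}} (ℕ.n<1+n (suc u))))

  window-above : ∀ {α} n .{{_ : ℕ.NonZero n}} → α <ᵣ b n →
    ∃[ v ] 1 ≤ v × ∀ i N .{{_ : ℕ.NonZero N}} → v ℕ.* s ℕ.^ i ≤ N → N ≤ suc v ℕ.* s ℕ.^ i → α <ᵣ b N
  -- `q₀` may be negative, while `c = A / q` needs `q > 0`. Taking `q` strictly below `A / r` also
  -- gives the slack `r < c` from which τ is obtained.
  window-above {α} n (q₀ , upper₀ , (r , upper-r , q₀r<a)) = enlarge (ℚ.<-dense q₀⊔0<a/r)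
    where
    open ℚ.≤-Reasoning
    0<n : 0ℚ ℚ.< fromℕ n
    0<n = ℚ.<-≤-trans 0<1 (1≤fromℕ n)
    0<r = npow-upper-pos n upper-r
    A = fromℕ (a₀ n)
    0<A : 0ℚ ℚ.< A
    0<A = ℚ.<-≤-trans 0<n (fromℕ-mono-≤ (n≤a₀ n))
    q₀⊔0<a/r : q₀ ℚ.⊔ 0ℚ ℚ.< A * inv r 0<r
    q₀⊔0<a/r = ⊔-least-< {q₀} {0ℚ}
      (*-cancel-<ʳ 0<r (subst₂ ℚ._<_ refl (trans (cong fromℕ (a≡a₀ n)) (sym (*-inv-cancel A 0<r))) q₀r<a))
      (*-pos 0<A (inv-pos 0<r))
    enlarge : ∃[ q ] q₀ ℚ.⊔ 0ℚ ℚ.< q × q ℚ.< A * inv r 0<r →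
              ∃[ v ] 1 ≤ v × ∀ i N .{{_ : ℕ.NonZero N}} → v ℕ.* s ℕ.^ i ≤ N → N ≤ suc v ℕ.* s ℕ.^ i → α <ᵣ b N
    enlarge (q , q₀⊔0<q , q<A/r) =
      grow (above-grow 0<n 0<r r<c (upper⇒above 1<s s≤p 1≤p (1≤fromℕ n) upper-r))
      where
      0<q = ℚ.≤-<-trans (ℚ.p≤q⊔p q₀ 0ℚ) q₀⊔0<q
      upper : ℝ.Upper α q
      upper = ℝ.upper-closed α (ℚ.≤-<-trans (ℚ.p≤p⊔q q₀ 0ℚ) q₀⊔0<q) upper₀
      c = A * inv q 0<q
      qc≡A : q * c ≡ A
      qc≡A = trans (ℚ.*-comm q c) (*-inv-cancel A 0<q)
      r<c : r ℚ.< c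
      r<c = *-cancel-<ʳ 0<q (begin-strict
        r * q                 ≡⟨ ℚ.*-comm r q ⟩
        q * r                 <⟨ *-mono-<ʳ 0<r q<A/r ⟩
        A * inv r 0<r * r     ≡⟨ *-inv-cancel A 0<r ⟩
        A                     ≡⟨ *-inv-cancel A 0<q ⟨
        c * q                 ∎)
      0<c = ℚ.<-trans 0<r r<c
      grow : ∃[ τ ] 1ℚ ℚ.< τ × Above (τ * fromℕ n) c →
             ∃[ v ] 1 ≤ v × ∀ i N .{{_ : ℕ.NonZero N}} → v ℕ.* s ℕ.^ i ≤ N → N ≤ suc v ℕ.* s ℕ.^ i → α <ᵣ b N
      grow (τ , 1<τ , above) = v , 1≤v , λ i N lo hi →
        window-above′ {α} n upper 0<q 0<c qc≡A 1≤z above J i N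
          (scale-upper J i {z} {suc v} {N} 1+v≤sᴶz hi) (bottom i N lo)
        where
        z = τ * fromℕ n
        n<z : fromℕ n ℚ.< z
        n<z = subst (ℚ._< z) (ℚ.*-identityˡ (fromℕ n)) (*-mono-<ʳ 0<n 1<τ)
        1≤z : 1ℚ ℚ.≤ z
        1≤z = ℚ.≤-trans (1≤fromℕ n) (ℚ.<⇒≤ n<z)
        d = z - fromℕ n
        large = sᴶ-large 1ℚ {d} (x<y⇒0<y-x n<z)
        J = proj₁ large
        T = s ℕ.^ J
        -- The left end of the block is itself admissible, so the window starts there and a gap of 1
        -- suffices.
        v = n ℕ.* T
        1≤v : 1 ≤ v
        1≤v = ℕ.*-mono-≤ (ℕ.>-nonZero⁻¹ n) (ℕ.m^n>0 s {{ℕ.>-nonZero (ℕ.<-≤-trans ℕ.z<s 2≤s)}} J)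
        1+v≤sᴶz : fromℕ (suc v) ℚ.≤ fromℕ T * z
        1+v≤sᴶz = begin
          fromℕ (suc v)                      ≡⟨ fromℕ-suc v ⟩
          1ℚ + fromℕ v                       ≡⟨ cong (_+_ 1ℚ) (trans (fromℕ-* n T) (ℚ.*-comm (fromℕ n) (fromℕ T))) ⟩
          1ℚ + fromℕ T * fromℕ n             ≤⟨ ℚ.+-monoˡ-≤ (fromℕ T * fromℕ n) (proj₂ large) ⟩
          fromℕ T * d + fromℕ T * fromℕ n    ≡⟨ ℚ.*-distribˡ-+ (fromℕ T) d (fromℕ n) ⟨
          fromℕ T * (d + fromℕ n)            ≡⟨ cong (fromℕ T *_) (x-y+y z (fromℕ n)) ⟩
          fromℕ T * z                        ∎
        bottom : ∀ i N → v ℕ.* s ℕ.^ i ≤ N → n ℕ.* s ℕ.^ (J ℕ.+ i) ≤ N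
        bottom i N lo = subst (_≤ N) (trans (ℕ.*-assoc n T (s ℕ.^ i))
          (cong (n ℕ.*_) (sym (ℕ.^-distribˡ-+-* s J i)))) lo

theorem3 : (p s : ℕ) (3≤p : 3 ≤ p) (2≤s : 2 ≤ s) (s<p : s < p)
    (A : Subset p) (#A≡s : ∣ A ∣ ≡ s)
    (h : Fin s → Fin p) (h-bij : IsIncreasingBijection A h) →
    let b = DigitSequence.b p s 2≤s s<p h in
    (m M : ℝ) → IsInfimum b m → IsSupremum b M →
    (α : ℝ) → m <ᵣ α → α <ᵣ M →
    ¬ ∃ λ (l : ℝ) → DensityTendsTo b α l
theorem3 p s _ 2≤s s<p A _ h h-bij m M (_ , greatest) (_ , least) α m<α α<M (l , lim) =
  -- No index is extracted from the infimum or the supremum. Refuting every `b_n < α` makes `α` a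
  -- lower bound, against `m < α`; given one such n, refuting every `b_n > α` makes it an upper
  -- bound, against `α < M`.
  greatest α (λ n bₙ<α → below n bₙ<α) m<α
  where
  open Windows p s 2≤s s<p h (IsIncreasingBijection.increasing h-bij)
  b : Sequence
  b = DigitSequence.b p s 2≤s s<p h
  below : ∀ n .{{_ : ℕ.NonZero n}} → ¬ (b n <ᵣ α)
  below n bₙ<α = let u , 1≤u , all = window-below {α} n bₙ<α in
    least α (λ n′ α<bₙ → let v , 1≤v , none = window-above {α} n′ α<bₙ in
      Density.windows-contradict b α l lim s 2≤s u v 1≤u 1≤v all
        (λ i N lo hi bN≤α → bN≤α (none i N lo hi))) α<M
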